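{- For each $1\le n\le\omega$ and every comeager set $C\subseteq X_n$, $F_n\le_B F_n\restriction C$.
   Context: Let $\mathbb N=\{0,1,2,\dots\}$ and identify $2^{\mathbb N}$ with $\mathcal P(\mathbb N)$. For $1\le m\le\omega$ and $x\in((2^{\mathbb N})^{\mathbb N})^m$ define recursively: $A^x_1=\{x(0)(k):k\in\mathbb N\}\subseteq 2^{\mathbb N}$; for $1\le j<m$ and $l\in\mathbb N$, $a^{x,l}_1=\{x(0)(k):x(1)(l)(k)=1\}$ and $a^{x,l}_{j}=\{a^{x,k}_{j-1}:x(j)(l)(k)=1\}$ for $j\ge 2$; and $A^x_{j+1}=\{a^{x,k}_j:k\in\mathbb N\}$ for $1\le j<m$. Let $X_1=(2^{\mathbb N})^{\mathbb N}$, and for $2\le n\le\omega$ let $X_n$ be the set of $x\in((2^{\mathbb N})^{\mathbb N})^n$ such that for every $1\le i<n$: (1) for every $m$ there is $k$ with $x(i)(k)(m)=1$; (2) for every $k$ there is $m$ with $x(i)(k)(m)=1$; (3) for all $k,l_1,l_2$, if $x(i-1)(l_1)=x(i-1)(l_2)$ then $x(i)(k)(l_1)=x(i)(k)(l_2)$. For $1\le n<\omega$, $F_n$ on $X_n$ is $x\mathrel{F_n}y\iff A^x_n=A^y_n$; $F_\omega$ on $X_\omega$ is $x\mathrel{F_\omega}y\iff A^x_j=A^y_j$ for all $1\le j<\omega$. -}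

module Defs where

open import Level using (0ℓ)
open import Data.Bool using (Bool; true)
open import Data.List using (List)
open import Data.List.Relation.Unary.All using (All)
open import Data.Nat using (ℕ; zero; suc; _≤_)
open import Data.Nat.Properties using (≤-refl; ≤-trans; n≤1+n)
open import Data.Product using (Σ; Σ-syntax; ∃-syntax; _×_; _,_; proj₁)
open import Function.Base using (_on_)
open import Function.Bundles using (_⇔_)
open import Relation.Binary.Core using (Rel)
open import Relation.Binary.PropositionalEquality using (_≡_; _≗_)
open import Relation.Nullary.Construct.Add.Supremum public using (_⁺; [_]; ⊤⁺)
open import Relation.Binary.Construct.Add.Supremum.NonStrict _≤_ public
  using (_≤⁺_; _≤⊤⁺; ≤⁺-trans) renaming ([_] to [_]≤)
open import Relation.Unary using (Pred; _∈_; _⊆_; _≐_; _⊢_; _≬_; ∁; ⋃; ⋂; Satisfiable)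

-- A topological space is presented by a base of its topology.  Points are
-- compared through the base only, so open and Borel sets are automatically
-- invariant under pointwise equality of the (function-valued) points below.

record Space : Set₁ where
  field
    Carrier : Set
    Base    : Set
    ⟦_⟧     : Base → Pred Carrier 0ℓ

open Space using (Carrier) public

Open : (S : Space) → Pred (Carrier S) 0ℓ → Set
Open S U = ∀ x → x ∈ U → ∃[ b ] x ∈ ⟦ b ⟧ × ⟦ b ⟧ ⊆ U
  where open Space S using (Base; ⟦_⟧)

Dense : (S : Space) → Pred (Carrier S) 0ℓ → Set₁
Dense S G = ∀ U → Open S U → Satisfiable U → U ≬ G

Comeager : (S : Space) → Pred (Carrier S) 0ℓ → Set₁
Comeager S C =
  Σ[ G ∈ (ℕ → Pred (Carrier S) 0ℓ) ]
    (∀ k → Open S (G k)) × (∀ k → Dense S (G k)) × ⋂ ℕ G ⊆ C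

data Borel (S : Space) : Pred (Carrier S) 0ℓ → Set₁ where
  open-set   : ∀ {U} → Open S U → Borel S U
  complement : ∀ {U} → Borel S U → Borel S (∁ U)
  union      : ∀ {U : ℕ → Pred (Carrier S) 0ℓ} → (∀ k → Borel S (U k)) → Borel S (⋃ ℕ U)
  -- Sets are extensional: predicates with the same elements are the same set.
  resp-≐     : ∀ {U V} → U ≐ V → Borel S U → Borel S V

BorelMap : (S T : Space) → (Carrier S → Carrier T) → Set₁
BorelMap S T f = ∀ V → Open T V → Borel S (f ⊢ V)

Subspace : (S : Space) → Pred (Carrier S) 0ℓ → Space
Subspace S P = record
  { Carrier = Σ (Carrier S) P
  ; Base    = Base
  ; ⟦_⟧     = λ b → proj₁ ⊢ ⟦ b ⟧
  }
  where open Space S using (Base; ⟦_⟧)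

-- E ≤B F, for relations E and F on the spaces S and T.
BorelReducible : (S T : Space) → Rel (Carrier S) 0ℓ → Rel (Carrier T) 0ℓ → Set₁
BorelReducible S T E F =
  Σ[ f ∈ (Carrier S → Carrier T) ]
    BorelMap S T f × (∀ x y → E x y ⇔ F (f x) (f y))

infixl 5 _↾_

_↾_ : {A : Set} → Rel A 0ℓ → (C : Pred A 0ℓ) → Rel (Σ A C) 0ℓ
E ↾ C = E on proj₁

-- Lengths n ≤ ω are elements of ℕ ⁺, with ω = ⊤⁺.

infix 4 _≺_

_≺_ : ℕ → ℕ ⁺ → Set
i ≺ n = [ suc i ] ≤⁺ n

≺-pred : ∀ {i n} → suc i ≺ n → i ≺ n
≺-pred = ≤⁺-trans ≤-trans [ n≤1+n _ ]≤

2^ℕ : Set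
2^ℕ = ℕ → Bool

-- ((2^ℕ)^ℕ)^n
Seqs : ℕ ⁺ → Set
Seqs n = (i : ℕ) → .(i ≺ n) → ℕ → 2^ℕ

-- A coordinate (i , k , m) of a point x, selecting the bit x(i)(k)(m).
record Coordinate (n : ℕ ⁺) : Set where
  constructor coord
  field
    row     : ℕ
    .row≺   : row ≺ n
    column  : ℕ
    place   : ℕ

bit : ∀ {n} → Seqs n → Coordinate n → Bool
bit x (coord i i≺n k m) = x i i≺n k m

-- The product topology: a basic open set prescribes finitely many bits.
SeqsSpace : ℕ ⁺ → Space
SeqsSpace n = record
  { Carrier = Seqs n
  ; Base    = List (Coordinate n × Bool)
  ; ⟦_⟧     = λ b x → All (λ (c , v) → bit x c ≡ v) b
  }

-- The conditions are stated for i + 1, with 1 ≤ i + 1 < n.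
record InX {n : ℕ ⁺} (x : Seqs n) : Set where
  field
    covering : ∀ i (p : suc i ≺ n) m → ∃[ k ] x (suc i) p k m ≡ true
    nonempty : ∀ i (p : suc i ≺ n) k → ∃[ m ] x (suc i) p k m ≡ true
    coherent : ∀ i (p : suc i ≺ n) k l₁ l₂ →
               x i (≺-pred p) l₁ ≗ x i (≺-pred p) l₂ →
               x (suc i) p k l₁ ≡ x (suc i) p k l₂

X : ℕ ⁺ → Space
X n = Subspace (SeqsSpace n) InX

-- HSet j is the j-fold iterated power set of 2^ℕ: set I f is the set
-- { f i : i ∈ I }, and _≈_ is extensional equality of sets.

data HSet : ℕ → Set₁ where
  pt  : 2^ℕ → HSet 0
  set : ∀ {j} (I : Set) → (I → HSet j) → HSet (suc j)

infix 4 _≈_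

_≈_ : ∀ {j} → HSet j → HSet j → Set
pt a    ≈ pt b    = a ≗ b
set I f ≈ set J g = (∀ i → ∃[ j ] f i ≈ g j) × (∀ j → ∃[ i ] f i ≈ g j)

module _ {n : ℕ ⁺} (x : Seqs n) where

  -- a j l is a_j^{x,l} for 1 ≤ j < n; a 0 l is x(0)(l), so that the recursion
  -- also yields a_1^{x,l} from x(0).
  a : (j : ℕ) → .(j ≺ n) → ℕ → HSet j
  a zero    p l = pt (x 0 p l)
  a (suc j) p l = set (∃[ k ] x (suc j) p l k ≡ true) (λ (k , _) → a j (≺-pred p) k)

  -- A j is A_{j+1}^x, for j < n.
  A : (j : ℕ) → .(j ≺ n) → HSet (suc j)
  A j p = set ℕ (a j p)

F : (n : ℕ ⁺) → [ 1 ] ≤⁺ n → Rel (Carrier (X n)) 0ℓ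
F [ zero ]  [ () ]≤
F [ suc j ] _ (x , _) (y , _) = A x j [ ≤-refl ]≤ ≈ A y j [ ≤-refl ]≤
F ⊤⁺        _ (x , _) (y , _) = ∀ j → A x j (_ ≤⊤⁺) ≈ A y j (_ ≤⊤⁺)

{-# OPTIONS --safe #-}
module Submission where

-- Padding by constantly true rows turns points of X_n into points of X_ω.  For
-- such a point x, consider "objects" of level i: an object consists of finitely
-- many of the sets a_j^{x,k} with j ≤ i, one of which is its top, and of a label
-- in ℕ.  An object of level 0 is sent to a real given by a Mycielski fusion, so
-- that distinct objects have mutually generic reals, and an object of level
-- i + 1 is sent to the set of (the images of) those objects of level i which its
-- label and theirs declare to be its elements.  Labels are rich enough for the
-- extension property: a new object can be chosen with its real in any open set
-- and any given membership relations to finitely many distinct objects.  Hence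
-- the objects can be enumerated, level by level, so that the resulting point y
-- lies in given countably many dense open sets, and least choices make x ↦ y
-- Borel.  The sets A_j^y depend only on the sets A_j^x, as do the objects;
-- conversely, labels and tops of the objects can be read off from A_j^y.

open import Defs
open import Level using (0ℓ)
open import Data.Nat using (ℕ)
open import Relation.Unary using (Pred)
open import Axiom.ExcludedMiddle using (ExcludedMiddle)
open import Data.Bool using (Bool; true; false; if_then_else_; T)
open import Data.Bool.Properties using (⇔→≡) renaming (_≟_ to _≟ᵇ_)
open import Data.Empty using (⊥)
open import Data.List
  using (List; []; _∷_; _++_; length; map; take; concat; applyUpTo; upTo; cartesianProduct; cartesianProductWith)
open import Data.List.Properties
  using (length-applyUpTo; length-map; length-++; map-∘; map-cong; ∷-injective; ++-assoc; ++-identityʳ)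
  renaming (≡-dec to List-≡-dec)
open import Data.List.Membership.Propositional using () renaming (_∈_ to _∈ₗ_)
open import Data.List.Membership.Propositional.Properties
  using (∈-cartesianProductWith⁺; ∈-cartesianProduct⁺; ∈-upTo⁺; ∈-map⁺; ∈-++⁺ˡ; ∈-++⁺ʳ; ∈-concat⁺′; ∈-applyUpTo⁺)
open import Data.List.Relation.Unary.All as All using (All; []; _∷_)
open import Data.List.Relation.Unary.All.Properties using () renaming (++⁺ to All-++⁺; ++⁻ˡ to All-++⁻ˡ; ++⁻ʳ to All-++⁻ʳ)
open import Data.List.Relation.Unary.Any using (here; there)
open import Data.List.Relation.Binary.Pointwise as Pw using (Pointwise; []; _∷_)
open import Data.Maybe as Maybe using (Maybe; just; nothing)
open import Data.Maybe.Properties using (just-injective)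
open import Data.Nat hiding (ℕ)
open import Data.Nat.Properties
open import Data.Product using (Σ; Σ-syntax; ∃-syntax; _×_; _,_; proj₁; proj₂)
open import Data.Product.Properties using () renaming (≡-dec to ×-≡-dec)
open import Data.Sum using (_⊎_; inj₁; inj₂)
open import Function using (_∘_; id; _⇔_; mk⇔; Equivalence)
open import Relation.Binary.Definitions using (tri<; tri≈; tri>)
open import Relation.Binary.PropositionalEquality
open import Relation.Nullary using (¬_; Dec; yes; no; does; contradiction; recompute)
open import Relation.Nullary.Decidable using (decidable-stable; dec-true; dec-false)

-- Two obstacles shape the objects. First, an object of level 0 is an infinite row: as soon as it is
-- listed, all bits of its real are fixed, although most dense sets are still to be met. Hence the
-- reals are prepared in advance, independently of the enumeration, so that any finite family of
-- distinct ones can still be continued into each dense set. On higher levels finitely many objects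
-- determine only finitely many bits, which a string can simply prescribe. Second, membership must
-- not depend on how `x` indexes its sets, yet a label is a finite datum and cannot name reals or
-- sets of reals. A table therefore recognises an object by its label together with the pattern of
-- equalities and memberships between its parameters and those of the deciding object. This is why
-- objects carry places besides their top: a new object collects the places of all objects that it
-- has to tell apart, and some members of level `i` distinguishing those of level `i + 1`.

private variable
  I K : Set

-- Lists with a default value and bounds over finite ranges

nth : I → List I → ℕ → I
nth d []       _       = d
nth d (a ∷ _)  zero    = a
nth d (_ ∷ as) (suc n) = nth d as n

nth-applyUpTo : ∀ {d : I} (f : ℕ → I) {N c} → c < N → nth d (applyUpTo f N) c ≡ f c
nth-applyUpTo f {suc N} {zero}  _         = refl
nth-applyUpTo f {suc N} {suc c} (s≤s c<N) = nth-applyUpTo (f ∘ suc) c<N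

nth-++ : ∀ {d : I} σ {τ c} → c < length σ → nth d (σ ++ τ) c ≡ nth d σ c
nth-++ (a ∷ σ) {c = zero}  _       = refl
nth-++ (a ∷ σ) {c = suc c} (s≤s p) = nth-++ σ p

nth-length : ∀ {d : I} σ {a τ} → nth d (σ ++ a ∷ τ) (length σ) ≡ a
nth-length []      = refl
nth-length (_ ∷ σ) = nth-length σ

nth-map : ∀ {d : I} (f : I → K) as n → nth (f d) (map f as) n ≡ f (nth d as n)
nth-map f []       n       = refl
nth-map f (a ∷ as) zero    = refl
nth-map f (a ∷ as) (suc n) = nth-map f as n

nth-nothing : ∀ (as : List (Maybe I)) {n a} → nth nothing as n ≡ just a → n < length as
nth-nothing (_ ∷ as) {zero}  _ = s≤s z≤n
nth-nothing (_ ∷ as) {suc n} p = s≤s (nth-nothing as p)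

bounded : (f : ℕ → ℕ) (B : ℕ) → ∃[ N ] (∀ l → l < B → f l < N)
bounded f zero    = 0 , λ _ ()
bounded f (suc B) with bounded f B
... | N , p = suc (f B) ⊔ N , λ l l<1+B → case (m≤n⇒m<n∨m≡n (s≤s⁻¹ l<1+B))
  where
  case : ∀ {l} → l < B ⊎ l ≡ B → f l < suc (f B) ⊔ N
  case (inj₁ l<B)  = ≤-trans (p _ l<B) (m≤n⊔m (suc (f B)) N)
  case (inj₂ refl) = m≤m⊔n (suc (f B)) N

bounded₂ : (f : ℕ → ℕ → ℕ) (B : ℕ) (C : ℕ → ℕ) → ∃[ N ] (∀ l m → l < B → m < C l → f l m < N)
bounded₂ f B C with bounded (λ l → proj₁ (bounded (f l) (C l))) B
... | N , p = N , λ l m l<B m<C → <-trans (proj₂ (bounded (f l) (C l)) m m<C) (p l l<B)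

-- Pairing and countable types

abstract
  next : ℕ × ℕ → ℕ × ℕ
  next (a , zero)  = 0 , suc a
  next (a , suc b) = suc a , b

  unpair : ℕ → ℕ × ℕ
  unpair zero    = 0 , 0
  unpair (suc n) = next (unpair n)

  triangle : ℕ → ℕ
  triangle zero    = 0
  triangle (suc n) = suc n + triangle n

  -- Cantor's pairing along antidiagonals: `triangle n` counts the pairs with sum below `n`.
  pair : ℕ → ℕ → ℕ
  pair a b = a + triangle (a + b)

  pair-next : ∀ a b → pair (proj₁ (next (a , b))) (proj₂ (next (a , b))) ≡ suc (pair a b)
  pair-next a zero    = cong (λ c → suc (a + triangle c)) (sym (+-identityʳ a))
  pair-next a (suc b) = cong (λ c → suc (a + triangle c)) (sym (+-suc a b))

  pair-unpair : ∀ n → pair (proj₁ (unpair n)) (proj₂ (unpair n)) ≡ n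
  pair-unpair zero    = refl
  pair-unpair (suc n) =
    trans (pair-next (proj₁ (unpair n)) (proj₂ (unpair n))) (cong suc (pair-unpair n))

  unpair-pair : ∀ a b → unpair (pair a b) ≡ (a , b)
  unpair-pair a b = go (pair a b) a b refl
    where
    go : ∀ n a b → pair a b ≡ n → unpair n ≡ (a , b)
    go zero    zero    zero    _ = refl
    go (suc n) zero    (suc b) e =
      cong next (go n b 0 (suc-injective (trans (sym (pair-next b 0)) e)))
    go n       (suc a) b       e = step n e
      where
      step : ∀ n → pair (suc a) b ≡ n → unpair n ≡ (suc a , b)
      step (suc n) e = cong next (go n a (suc b) (suc-injective (trans (sym (pair-next a (suc b))) e)))

  n≤triangle : ∀ n → n ≤ triangle n
  n≤triangle zero    = z≤n
  n≤triangle (suc n) = m≤m+n (suc n) (triangle n)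

  fst≤pair : ∀ a b → a ≤ pair a b
  fst≤pair a b = m≤m+n a _

  snd≤pair : ∀ a b → b ≤ pair a b
  snd≤pair a b = ≤-trans (m≤n+m b a) (≤-trans (n≤triangle (a + b)) (m≤n+m _ a))

Countable : Set → Set
Countable I = Σ[ f ∈ (ℕ → I) ] (∀ a → ∃[ n ] f n ≡ a)

countable-ℕ : Countable ℕ
countable-ℕ = id , λ n → n , refl

countable-Bool : Countable Bool
countable-Bool = f , λ { false → 0 , refl ; true → 1 , refl }
  where
  f : ℕ → Bool
  f zero    = false
  f (suc _) = true

countable-image : (f : I → K) → (∀ b → ∃[ a ] f a ≡ b) → Countable I → Countable K
countable-image f onto (e , p) = f ∘ e , λ b →
  let (a , fa≡b) = onto b ; (n , en≡a) = p a in n , trans (cong f en≡a) fa≡b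

countable-× : Countable I → Countable K → Countable (I × K)
countable-× (e , p) (e′ , p′) =
  (λ n → e (proj₁ (unpair n)) , e′ (proj₂ (unpair n))) , λ (a , b) →
  let (m , q) = p a ; (n , q′) = p′ b in
  pair m n , trans (cong (λ c → e (proj₁ c) , e′ (proj₂ c)) (unpair-pair m n)) (cong₂ _,_ q q′)

countable-List : Countable I → Countable (List I)
countable-List {I} (e , p) = (λ n → decode (proj₁ (unpair n)) (proj₂ (unpair n))) , λ as →
  let (n , q) = onto as in
  pair (length as) n ,
  trans (cong (λ c → decode (proj₁ c) (proj₂ c)) (unpair-pair (length as) n)) q
  where
  decode : ℕ → ℕ → List I
  decode zero    _ = []
  decode (suc l) n = e (proj₁ (unpair n)) ∷ decode l (proj₂ (unpair n))
  onto : ∀ as → ∃[ n ] decode (length as) n ≡ as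
  onto []       = 0 , refl
  onto (a ∷ as) =
    let (m , q) = p a ; (n , q′) = onto as in
    pair m n , trans (cong (λ c → e (proj₁ c) ∷ decode (length as) (proj₂ c)) (unpair-pair m n))
                     (cong₂ _∷_ q q′)

listsUpTo : List I → ℕ → List (List I)
listsUpTo as zero    = [] ∷ []
listsUpTo as (suc n) = [] ∷ cartesianProductWith _∷_ as (listsUpTo as n)

∈-listsUpTo : ∀ {as : List I} {n bs} → All (_∈ₗ as) bs → length bs ≤ n → bs ∈ₗ listsUpTo as n
∈-listsUpTo {n = zero}  []       _       = here refl
∈-listsUpTo {n = suc n} []       _       = here refl
∈-listsUpTo {n = suc n} (b ∷ bs) (s≤s l) = there (∈-cartesianProductWith⁺ _∷_ b (∈-listsUpTo bs l))

Eventually : (ℕ → Set) → Set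
Eventually P = ∃[ N ] (∀ s → N ≤ s → P s)

eventually-× : ∀ {P Q} → Eventually P → Eventually Q → Eventually (λ s → P s × Q s)
eventually-× (M , p) (N , q) = M ⊔ N , λ s M⊔N≤s →
  p s (≤-trans (m≤m⊔n M N) M⊔N≤s) , q s (≤-trans (m≤n⊔m M N) M⊔N≤s)

eventually-∀< : ∀ {P : ℕ → ℕ → Set} B → (∀ l → l < B → Eventually (P l)) →
                Eventually (λ s → ∀ l → l < B → P l s)
eventually-∀< zero    _ = 0 , λ _ _ _ ()
eventually-∀< {P} (suc B) p
  with eventually-∀< B (λ l l<B → p l (m<n⇒m<1+n l<B)) | p B (n<1+n B)
... | M , q | N , r = M ⊔ N , λ s M⊔N≤s l l<1+B → case s M⊔N≤s (m≤n⇒m<n∨m≡n (s≤s⁻¹ l<1+B))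
  where
  case : ∀ s → M ⊔ N ≤ s → ∀ {l} → l < B ⊎ l ≡ B → P l s
  case s M⊔N≤s (inj₁ l<B)  = q s (≤-trans (m≤m⊔n M N) M⊔N≤s) _ l<B
  case s M⊔N≤s (inj₂ refl) = r s (≤-trans (m≤n⊔m M N) M⊔N≤s)

-- Finite binary strings and the coding of bits

String : Set
String = List Bool

at : String → ℕ → Bool
at = nth false

infix 4 _⊑_

record _⊑_ (σ τ : String) : Set where
  constructor extends
  field
    longer : length σ ≤ length τ
    agrees : ∀ c → c < length σ → at τ c ≡ at σ c

open _⊑_

⊑-refl : ∀ {σ} → σ ⊑ σ
⊑-refl = extends ≤-refl (λ _ _ → refl)

⊑-trans : ∀ {σ τ υ} → σ ⊑ τ → τ ⊑ υ → σ ⊑ υ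
⊑-trans (extends l p) (extends m q) =
  extends (≤-trans l m) (λ c c< → trans (q c (<-≤-trans c< l)) (p c c<))

⊑-++ : ∀ σ τ → σ ⊑ σ ++ τ
⊑-++ σ τ = extends (subst (length σ ≤_) (sym (length-++ σ)) (m≤m+n _ _)) (λ c → nth-++ σ)

W : Set
W = ℕ → ℕ → ℕ → Bool

-- With this nesting the code of a bit is at least the slot `pair i k` of its row, so a string of
-- length `N` concerns only rows in slots below `N`.
code : ℕ → ℕ → ℕ → ℕ
code i k m = pair (pair i k) m

slot≤code : ∀ i k m → pair i k ≤ code i k m
slot≤code i k m = fst≤pair (pair i k) m

place≤code : ∀ i k m → m ≤ code i k m
place≤code i k m = snd≤pair (pair i k) m

uncode : ℕ → ℕ × ℕ × ℕ
uncode c = let (s , m) = unpair c ; (i , k) = unpair s in i , k , m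

flat : W → ℕ → Bool
flat w c = let (i , k , m) = uncode c in w i k m

uncode-code : ∀ i k m → uncode (code i k m) ≡ (i , k , m)
uncode-code i k m rewrite unpair-pair (pair i k) m | unpair-pair i k = refl

flat-code : ∀ w i k m → flat w (code i k m) ≡ w i k m
flat-code w i k m = cong (λ (i , k , m) → w i k m) (uncode-code i k m)

code-uncode : ∀ c → let (i , k , m) = uncode c in code i k m ≡ c
code-uncode c = trans (cong (λ s → pair s (proj₂ (unpair c))) (pair-unpair (proj₁ (unpair c)))) (pair-unpair c)

module Classical (em : ExcludedMiddle 0ℓ) where

  dne : {P : Set} → ¬ ¬ P → P
  dne = decidable-stable em

  ¬∀⇒∃¬ : {P : I → Set} → ¬ (∀ a → P a) → ∃[ a ] ¬ P a
  ¬∀⇒∃¬ f = dne λ g → f λ a → dne λ h → g (a , h)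

  truth : Set → Bool
  truth P = does (em {P})

  truth-yes : ∀ {P} → P → truth P ≡ true
  truth-yes = dec-true em

  truth⇒ : ∀ {P} → truth P ≡ true → P
  truth⇒ {P} e with em {P}
  ... | yes p = p

  truth-cong : ∀ {P Q} → (P → Q) → (Q → P) → truth P ≡ truth Q
  truth-cong f g = ⇔→≡ (mk⇔ (truth-yes ∘ f ∘ truth⇒) (truth-yes ∘ g ∘ truth⇒))

  Least : (ℕ → Set) → ℕ → Set
  Least P n = P n × (∀ m → m < n → ¬ P m)

  least : (P : ℕ → Set) → ∃[ n ] P n → ∃[ n ] Least P n
  least P (n , p) = go P n p
    where
    go : (P : ℕ → Set) → ∀ n → P n → ∃[ n ] Least P n
    go P zero    p = 0 , p , λ _ ()
    go P (suc n) p with em {P 0}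
    ... | yes p₀ = 0 , p₀ , λ _ ()
    ... | no ¬p₀ with go (P ∘ suc) n p
    ...   | m , q , r = suc m , q , λ { zero _ → ¬p₀ ; (suc l) (s≤s l<m) → r l l<m }

  least-unique : ∀ {P m n} → Least P m → Least P n → m ≡ n
  least-unique {m = m} {n} (p , q) (p′ , q′) with <-cmp m n
  ... | tri< m<n _ _ = contradiction p (q′ m m<n)
  ... | tri≈ _ m≡n _ = m≡n
  ... | tri> _ _ n<m = contradiction p′ (q n n<m)

-- Mutually generic reals by fusion

DenseFamily : (ℕ → String → Set) → Set
DenseFamily D = ∀ k (g : ℕ → Bool) N →
  ∃[ σ ] N ≤ length σ × (∀ c → c < N → at σ c ≡ g c) × D k σ

-- The fusion constructs a real ρ (L , r₁ ∷ … ∷ r_l ∷ []) for every label L and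
-- all reals r₁ , … , r_l.

Index : Set
Index = ℕ × List (ℕ → Bool)

Node : Set
Node = ℕ × List String

trunc : ℕ → (ℕ → Bool) → String
trunc s r = applyUpTo r s

approx : ℕ → Index → Node
approx s (L , rs) = L , map (trunc s) rs

cut : ℕ → Node → Node
cut s (L , σs) = L , map (take s) σs

take-applyUpTo : (f : ℕ → I) (s : ℕ) → take s (applyUpTo f (suc s)) ≡ applyUpTo f s
take-applyUpTo f zero    = refl
take-applyUpTo f (suc s) = cong (f 0 ∷_) (take-applyUpTo (f ∘ suc) s)

cut-approx : ∀ s ι → cut s (approx (suc s) ι) ≡ approx s ι
cut-approx s (L , rs) = cong (L ,_) (trans (sym (map-∘ rs)) (map-cong (λ r → take-applyUpTo r s) rs))

infix 4 _≋_

-- Reals are functions without extensionality, so indices are compared through all their finite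
-- truncations.
_≋_ : Index → Index → Set
ι ≋ κ = ∀ s → approx s ι ≡ approx s κ

approx-≡-antitone : ∀ {s t ι κ} → s ≤ t → approx t ι ≡ approx t κ → approx s ι ≡ approx s κ
approx-≡-antitone {s} {ι = ι} {κ} s≤t e = go (≤⇒≤′ s≤t) e
  where
  go : ∀ {t} → s ≤′ t → approx t ι ≡ approx t κ → approx s ι ≡ approx s κ
  go ≤′-refl e = e
  go (≤′-step {t} s≤t) e =
    go s≤t (trans (sym (cut-approx t ι)) (trans (cong (cut t) e) (cut-approx t κ)))

allNodes : ℕ → List Node
allNodes s = cartesianProduct (upTo s) (listsUpTo (listsUpTo (true ∷ false ∷ []) s) s)

∈-bools : ∀ b → b ∈ₗ true ∷ false ∷ []
∈-bools true  = here refl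
∈-bools false = there (here refl)

approx∈allNodes : ∀ {s} ι → proj₁ ι < s → length (proj₂ ι) ≤ s → approx s ι ∈ₗ allNodes s
approx∈allNodes {s} (L , rs) L<s len = ∈-cartesianProduct⁺ (∈-upTo⁺ L<s)
  (∈-listsUpTo (all rs) (subst (_≤ s) (sym (length-map _ rs)) len))
  where
  all : ∀ rs → All (_∈ₗ listsUpTo (true ∷ false ∷ []) s) (map (trunc s) rs)
  all []       = []
  all (r ∷ rs) =
    ∈-listsUpTo (All.universal ∈-bools _) (≤-reflexive (length-applyUpTo r s)) ∷ all rs

-- Mycielski's theorem by a fusion argument: stage s fixes a string φ s ν for
-- each node ν of depth s, and meets the first s requirements for all finite
-- families of distinct nodes of that depth.

module Fusion (em : ExcludedMiddle 0ℓ) (D : ℕ → String → Set) (dense : DenseFamily D)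
              (str : ℕ → String) where
  open Classical em

  private
    Approximation : Set
    Approximation = Node → String

    -- In `(ν , τ , k)`, the list `ν` assigns nodes to rows of level 0 and leaves `nothing` rows
    -- free, `τ` prescribes bits of the higher levels, and `D k` is the set to be met.
    Requirement : Set
    Requirement = List (Maybe Node) × String × ℕ

    stringEnum : Countable String
    stringEnum = countable-List countable-Bool

    Injective : List (Maybe Node) → Set
    Injective ν = ∀ l l′ a → nth nothing ν l ≡ just a → nth nothing ν l′ ≡ just a → l ≡ l′

    -- Every bit of `σ` in an assigned row already lies within the string of its node, so later
    -- stages cannot spoil it.
    Met : Requirement → Approximation → Set
    Met (ν , τ , k) φ = ∃[ σ ]
      D k σ × length τ ≤ length σ ×
      (∀ l a → nth nothing ν l ≡ just a → ∀ m → code 0 l m < length σ →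
        m < length (φ a) × at (φ a) m ≡ at σ (code 0 l m)) ×
      (∀ i k m → code (suc i) k m < length τ → at σ (code (suc i) k m) ≡ at τ (code (suc i) k m))

    infix 4 _⊑ᶠ_

    record _⊑ᶠ_ (φ ψ : Approximation) : Set where
      constructor extendsᶠ
      field
        node : ∀ a → φ a ⊑ ψ a

    open _⊑ᶠ_

    Met-mono : ∀ {φ ψ} → φ ⊑ᶠ ψ → ∀ r → Met r φ → Met r ψ
    Met-mono φ⊑ψ r (σ , Dσ , len , rows , rest) = σ , Dσ , len , (λ l a e m c< →
      let (m< , eq) = rows l a e m c< in
      <-≤-trans m< (longer (node φ⊑ψ a)) , trans (agrees (node φ⊑ψ a) m m<) eq) , rest

    module Meeting (ν : List (Maybe Node)) (τ : String) (φ : Approximation) where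

      row : Maybe Node → ℕ → ℕ → Bool
      row nothing  l m = at τ (code 0 l m)
      row (just a) l m = at (φ a) m

      target : W
      target zero    l m = row (nth nothing ν l) l m
      target (suc i) l m = at τ (code (suc i) l m)

      len : Maybe Node → ℕ
      len nothing  = 0
      len (just a) = length (φ a)

      bound : ∃[ N ] (∀ l m → l < length ν → m < len (nth nothing ν l) → code 0 l m < N)
      bound = bounded₂ (code 0) (length ν) (len ∘ nth nothing ν)

      -- Long enough that a string agreeing with `target` below `N` respects `τ` and all bits
      -- already fixed for the assigned nodes.
      N : ℕ
      N = length τ ⊔ proj₁ bound

      module _ (σ : String) (N≤ : N ≤ length σ) (agree : ∀ c → c < N → at σ c ≡ flat target c) where

        -- The maximum with `length σ` captures every bit of the row that `σ` decides, since
        -- `code 0 l m < length σ` forces `m < length σ`.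
        row-length : Node → ℕ
        row-length a = length (φ a) ⊔ length σ

        selected : ∀ a → Dec (∃[ l ] nth nothing ν l ≡ just a) → String
        selected a (yes (l , _)) = applyUpTo (λ m → at σ (code 0 l m)) (row-length a)
        selected a (no _)        = φ a

        length-selected : ∀ l a → length (applyUpTo (λ m → at σ (code 0 l m)) (row-length a)) ≡ row-length a
        length-selected l a = length-applyUpTo _ (row-length a)

        ψ : Approximation
        ψ a = selected a em

        agree-row : ∀ l a → nth nothing ν l ≡ just a → ∀ m → m < length (φ a) →
                    at σ (code 0 l m) ≡ at (φ a) m
        agree-row l a e m m< = trans
          (agree (code 0 l m) (<-≤-trans
            (proj₂ bound l m (nth-nothing ν e) (subst (m <_) (sym (cong len e)) m<))
            (m≤n⊔m (length τ) _)))
          (trans (flat-code target 0 l m) (cong (λ x → row x l m) e))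

        φ⊑selected : ∀ a d → φ a ⊑ selected a d
        φ⊑selected a (no _)        = ⊑-refl
        φ⊑selected a (yes (l , e)) = extends
          (subst (length (φ a) ≤_) (sym (length-selected l a)) (m≤m⊔n _ _))
          (λ m m< → trans (nth-applyUpTo (λ m → at σ (code 0 l m)) (<-≤-trans m< (m≤m⊔n _ (length σ))))
                          (agree-row l a e m m<))

        selected-row : Injective ν → ∀ l a (d : Dec (∃[ l ] nth nothing ν l ≡ just a)) →
          nth nothing ν l ≡ just a → ∀ m → code 0 l m < length σ →
          m < length (selected a d) × at (selected a d) m ≡ at σ (code 0 l m)
        selected-row inj l a (no ¬e) e m c< = contradiction (l , e) ¬e
        selected-row inj l a (yes (l′ , e′)) e m c< with inj l l′ a e e′
        ... | refl = subst (m <_) (sym (length-selected l a)) m< ,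
                     nth-applyUpTo (λ m → at σ (code 0 l m)) m<
          where
          m< : m < row-length a
          m< = <-≤-trans (≤-<-trans (place≤code 0 l m) c<) (m≤n⊔m (length (φ a)) _)

    -- If a node is assigned to several rows, `selected` copies one of them, which still extends the
    -- old string; injectivity is what makes all assigned rows come out right.
    meet : ∀ r φ → ∃[ ψ ] φ ⊑ᶠ ψ × (Injective (proj₁ r) → Met r ψ)
    meet (ν , τ , k) φ with dense k (flat (Meeting.target ν τ φ)) (Meeting.N ν τ φ)
    ... | σ , N≤ , agree , Dσ =
      ψ σ N≤ agree , extendsᶠ (λ a → φ⊑selected σ N≤ agree a em) , λ inj →
      σ , Dσ , ≤-trans (m≤m⊔n _ _) N≤ , (λ l a → selected-row σ N≤ agree inj l a em) , λ i l m c< →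
        trans (agree _ (<-≤-trans c< (m≤m⊔n _ _))) (flat-code target (suc i) l m)
      where open Meeting ν τ φ

    meetAll : ∀ rs φ → ∃[ ψ ] φ ⊑ᶠ ψ × All (λ r → Injective (proj₁ r) → Met r ψ) rs
    meetAll []       φ = φ , extendsᶠ (λ _ → ⊑-refl) , []
    meetAll (r ∷ rs) φ with meet r φ
    ... | ψ , φ⊑ψ , met with meetAll rs ψ
    ...   | χ , ψ⊑χ , mets =
      χ , extendsᶠ (λ a → ⊑-trans (node φ⊑ψ a) (node ψ⊑χ a)) , (Met-mono ψ⊑χ r ∘ met) ∷ mets

    abstract
      requirements : ℕ → List Requirement
      requirements s = cartesianProduct (listsUpTo (nothing ∷ map just (allNodes s)) s)
                         (cartesianProduct (map (proj₁ stringEnum) (upTo s)) (upTo s))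

      ∈-requirements : ∀ {s ν t k} → All (_∈ₗ nothing ∷ map just (allNodes s)) ν → length ν ≤ s →
                       t < s → k < s → (ν , proj₁ stringEnum t , k) ∈ₗ requirements s
      ∈-requirements ν∈ len t< k< =
        ∈-cartesianProduct⁺ (∈-listsUpTo ν∈ len)
          (∈-cartesianProduct⁺ (∈-map⁺ (proj₁ stringEnum) (∈-upTo⁺ t<)) (∈-upTo⁺ k<))

    improved : ∀ s φ → ∃[ ψ ] φ ⊑ᶠ ψ × All (λ r → Injective (proj₁ r) → Met r ψ) (requirements s)
    improved s φ = meetAll (requirements s) φ

    φ : ℕ → Approximation
    φ zero    (L , _) = str L
    -- A node starts from the string of its truncation; the appended bit forces growth, so that
    -- every branch defines a total real.
    φ (suc s) a       = proj₁ (improved (suc s) (φ s ∘ cut s)) a ++ false ∷ []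

    φ-step : ∀ s a → φ s (cut s a) ⊑ φ (suc s) a
    φ-step s a = ⊑-trans (node (proj₁ (proj₂ (improved (suc s) (φ s ∘ cut s)))) a) (⊑-++ _ _)

    φ-met : ∀ s {r} → r ∈ₗ requirements (suc s) → Injective (proj₁ r) → Met r (φ (suc s))
    φ-met s {r} r∈ inj = Met-mono {proj₁ (improved (suc s) (φ s ∘ cut s))} (extendsᶠ (λ _ → ⊑-++ _ _)) r
      (All.lookup (proj₂ (proj₂ (improved (suc s) (φ s ∘ cut s)))) r∈ inj)

    φ-length : ∀ s a → s ≤ length (φ s a)
    φ-length zero    a = z≤n
    φ-length (suc s) a = subst (suc s ≤_) (sym (length-++ ψa))
      (subst (suc s ≤_) (+-comm 1 (length ψa)) (s≤s (≤-trans (φ-length s (cut s a))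
        (longer (node (proj₁ (proj₂ (improved (suc s) (φ s ∘ cut s)))) a)))))
      where
      ψa : String
      ψa = proj₁ (improved (suc s) (φ s ∘ cut s)) a

    φ-mono : ∀ {s t} ι → s ≤ t → φ s (approx s ι) ⊑ φ t (approx t ι)
    φ-mono {s} ι s≤t = go (≤⇒≤′ s≤t)
      where
      go : ∀ {t} → s ≤′ t → φ s (approx s ι) ⊑ φ t (approx t ι)
      go ≤′-refl           = ⊑-refl
      go (≤′-step {t} s≤t) = ⊑-trans (go s≤t)
        (subst (λ a → φ t a ⊑ φ (suc t) (approx (suc t) ι)) (cut-approx t ι) (φ-step t _))

  -- Strings of stage `suc m` are longer than `m`, so bit `m` of a real depends only on a finite
  -- node; hence `ρ` will be Borel in the rows of its index.
  ρ-at : ℕ → Node → Bool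
  ρ-at m a = at (φ (suc m) a) m

  ρ : Index → ℕ → Bool
  ρ ι m = ρ-at m (approx (suc m) ι)

  private
    ρ-φ : ∀ s ι m → m < length (φ s (approx s ι)) → ρ ι m ≡ at (φ s (approx s ι)) m
    ρ-φ s ι m m< with ≤-total s (suc m)
    ... | inj₁ s≤ = agrees (φ-mono ι s≤) m m<
    ... | inj₂ ≤s = sym (agrees (φ-mono ι ≤s) m (φ-length (suc m) _))

  ρ-cong : ∀ {ι κ} → ι ≋ κ → ρ ι ≗ ρ κ
  ρ-cong eq m = cong (ρ-at m) (eq (suc m))

  ρ-str : ∀ ι m → m < length (str (proj₁ ι)) → ρ ι m ≡ at (str (proj₁ ι)) m
  ρ-str ι = ρ-φ 0 ι

  -- At a late stage the truncations of distinct indices are distinct nodes and the requirement is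
  -- on the list of that stage; what is met there persists in the limit.
  ρ-generic : ∀ (T : List (Maybe Index)) →
    (∀ l l′ ι κ → nth nothing T l ≡ just ι → nth nothing T l′ ≡ just κ → ι ≋ κ → l ≡ l′) →
    ∀ τ k → ∃[ σ ] D k σ × length τ ≤ length σ ×
      (∀ l ι → nth nothing T l ≡ just ι → ∀ m → code 0 l m < length σ → at σ (code 0 l m) ≡ ρ ι m) ×
      (∀ i k m → code (suc i) k m < length τ → at σ (code (suc i) k m) ≡ at τ (code (suc i) k m))
  ρ-generic T distinct τ k =
    let (σ , Dσ , len , rows , rest) = φ-met s req inj in
    σ , Dσ , len , (λ l ι e m c< →
      let (m< , eq) = rows l (approx (suc s) ι) (nth-nodes e) m c< in
      trans (sym eq) (sym (ρ-φ (suc s) ι m m<))) , rest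
    where
    Separated : ℕ → ℕ → ℕ → Set
    Separated l l′ s = ∀ ι κ → nth nothing T l ≡ just ι → nth nothing T l′ ≡ just κ →
                       approx s ι ≡ approx s κ → l ≡ l′

    separated : ∀ l l′ → Eventually (Separated l l′)
    separated l l′ with nth nothing T l in e | nth nothing T l′ in e′
    ... | nothing | _       = 0 , λ _ _ _ _ ()
    ... | just _  | nothing = 0 , λ _ _ _ _ _ ()
    ... | just ι  | just κ  with em {ι ≋ κ}
    ...   | yes ι≋κ = 0 , λ _ _ _ _ _ _ _ → distinct l l′ ι κ e e′ ι≋κ
    ...   | no ι≉κ with ¬∀⇒∃¬ ι≉κ
    ...     | s , ≢ = s , λ { t s≤t _ _ refl refl eq → contradiction (approx-≡-antitone s≤t eq) ≢ }

    Small : Maybe Index → ℕ → Set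
    Small x s = ∀ ι → x ≡ just ι → proj₁ ι < s × length (proj₂ ι) ≤ s

    small : ∀ x → Eventually (Small x)
    small nothing  = 0 , λ _ _ _ ()
    small (just (L , rs)) = suc L ⊔ length rs , λ { s ≤s _ refl →
      ≤-trans (m≤m⊔n (suc L) (length rs)) ≤s , ≤-trans (m≤n⊔m (suc L) (length rs)) ≤s }

    tau : ∃[ n ] proj₁ stringEnum n ≡ τ
    tau = proj₂ stringEnum τ

    stage : Eventually λ s →
      (∀ l → l < length T → ∀ l′ → l′ < length T → Separated l l′ s) ×
      (∀ l → l < length T → Small (nth nothing T l) s) ×
      (length T ≤ s × proj₁ tau < s × k < s)
    stage =
      eventually-× (eventually-∀< (length T) λ l _ → eventually-∀< (length T) λ l′ _ → separated l l′)
      (eventually-× (eventually-∀< (length T) λ l _ → small (nth nothing T l))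
      (eventually-× (length T , λ _ → id) (eventually-× (suc (proj₁ tau) , λ _ → id) (suc k , λ _ → id))))

    s : ℕ
    s = proj₁ stage

    at-stage = proj₂ stage (suc s) (n≤1+n s)

    nodes : List (Maybe Node)
    nodes = map (Maybe.map (approx (suc s))) T

    nth-nodes : ∀ {l ι} → nth nothing T l ≡ just ι → nth nothing nodes l ≡ just (approx (suc s) ι)
    nth-nodes {l} e = trans (nth-map (Maybe.map (approx (suc s))) T l) (cong (Maybe.map _) e)

    nth-nodes⁻ : ∀ {l a} → nth nothing nodes l ≡ just a → ∃[ ι ] nth nothing T l ≡ just ι × approx (suc s) ι ≡ a
    nth-nodes⁻ {l} {a} e = go (nth nothing T l) refl (trans (sym (nth-map (Maybe.map (approx (suc s))) T l)) e)
      where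
      go : ∀ x → nth nothing T l ≡ x → Maybe.map (approx (suc s)) x ≡ just a →
           ∃[ ι ] nth nothing T l ≡ just ι × approx (suc s) ι ≡ a
      go (just ι) e refl = ι , e , refl

    inj : Injective nodes
    inj l l′ a e e′ with nth-nodes⁻ e | nth-nodes⁻ e′
    ... | ι , p , refl | κ , q , eq = proj₁ at-stage l (nth-nothing T p) l′ (nth-nothing T q) ι κ p q (sym eq)

    nodes∈ : ∀ T → (∀ l → l < length T → Small (nth nothing T l) (suc s)) →
             All (_∈ₗ (nothing ∷ map just (allNodes (suc s)))) (map (Maybe.map (approx (suc s))) T)
    nodes∈ []            _ = []
    nodes∈ (nothing ∷ T) p = here refl ∷ nodes∈ T (λ l l< → p (suc l) (s≤s l<))
    nodes∈ (just ι ∷ T)  p =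
      there (∈-map⁺ just (let (a , b) = p 0 (s≤s z≤n) ι refl in approx∈allNodes ι a b)) ∷
      nodes∈ T (λ l l< → p (suc l) (s≤s l<))

    req : (nodes , τ , k) ∈ₗ requirements (suc s)
    req = let (_ , sm , len , t< , k<) = at-stage in
      subst (λ σ → (nodes , σ , k) ∈ₗ requirements (suc s)) (proj₂ tau)
        (∈-requirements (nodes∈ T sm) (subst (_≤ suc s) (sym (length-map _ T)) len) t< k<)

-- Equality of the sets coded by two points

Coherent : W → Set
Coherent x = ∀ i k l₁ l₂ → x i l₁ ≗ x i l₂ → x (suc i) k l₁ ≡ x (suc i) k l₂

Covering : W → Set
Covering x = ∀ i m → ∃[ k ] x (suc i) k m ≡ true

-- Sim x x′ j l l′ says that the sets a_j^{x,l} and a_j^{x′,l′} are equal.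

Sim : W → W → ℕ → ℕ → ℕ → Set
Sim x x′ zero    l l′ = x 0 l ≗ x′ 0 l′
Sim x x′ (suc j) l l′ =
  (∀ k → x (suc j) l k ≡ true → ∃[ k′ ] x′ (suc j) l′ k′ ≡ true × Sim x x′ j k k′) ×
  (∀ k′ → x′ (suc j) l′ k′ ≡ true → ∃[ k ] x (suc j) l k ≡ true × Sim x x′ j k k′)

SameSets : W → W → ℕ → Set
SameSets x x′ j = (∀ l → ∃[ l′ ] Sim x x′ j l l′) × (∀ l′ → ∃[ l ] Sim x x′ j l l′)

module _ {x : W} where

  Sim-refl : ∀ j l → Sim x x j l l
  Sim-refl zero    l   = λ _ → refl
  Sim-refl (suc j) l = (λ k e → k , e , Sim-refl j k) , (λ k e → k , e , Sim-refl j k)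

module _ {x x′ : W} where

  Sim-sym : ∀ j {l l′} → Sim x x′ j l l′ → Sim x′ x j l′ l
  Sim-sym zero    e       = λ m → sym (e m)
  Sim-sym (suc j) (f , g) =
    (λ k e → let (k′ , e′ , s) = g k e in k′ , e′ , Sim-sym j s) ,
    (λ k e → let (k′ , e′ , s) = f k e in k′ , e′ , Sim-sym j s)

  Sim-extʳ : ∀ j {l l′ l″} → x′ j l′ ≗ x′ j l″ → Sim x x′ j l l′ → Sim x x′ j l l″
  Sim-extʳ zero    eq e       = λ m → trans (e m) (eq m)
  Sim-extʳ (suc j) eq (f , g) =
    (λ k e → let (k′ , e′ , s) = f k e in k′ , trans (sym (eq k′)) e′ , s) ,
    (λ k′ e → g k′ (trans (eq k′) e))

  Sim-unique : Coherent x′ → ∀ j {k k′ k″} → Sim x x′ j k k′ → Sim x x′ j k k″ → x′ j k′ ≗ x′ j k″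
  Sim-unique coh zero    e       e′        m = trans (sym (e m)) (e′ m)
  Sim-unique coh (suc j) (f , g) (f′ , g′) m = ⇔→≡ (mk⇔ (transfer f′ g) (transfer f g′))
    where
    transfer : ∀ {k k′ k″} →
      (∀ m → x (suc j) k m ≡ true → ∃[ m′ ] x′ (suc j) k″ m′ ≡ true × Sim x x′ j m m′) →
      (∀ m → x′ (suc j) k′ m ≡ true → ∃[ m′ ] x (suc j) k m′ ≡ true × Sim x x′ j m′ m) →
      x′ (suc j) k′ m ≡ true → x′ (suc j) k″ m ≡ true
    transfer f g e =
      let (m₀ , e₀ , s) = g m e ; (m₁ , e₁ , s′) = f m₀ e₀ in
      trans (coh j _ m m₁ (Sim-unique coh j s s′)) e₁

module _ {x x′ : W} where

  Sim-extˡ : ∀ j {l l″ l′} → x j l ≗ x j l″ → Sim x x′ j l″ l′ → Sim x x′ j l l′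
  Sim-extˡ j eq s = Sim-sym j (Sim-extʳ j (λ m → sym (eq m)) (Sim-sym j s))

  Sim-bit⇒ : Coherent x′ → ∀ j {k k′ l l′} → Sim x x′ j k k′ → Sim x x′ (suc j) l l′ →
             x (suc j) l k ≡ true → x′ (suc j) l′ k′ ≡ true
  Sim-bit⇒ coh j {k} {k′} s (f , _) e =
    let (k″ , e″ , s″) = f k e in
    trans (coh j _ k′ k″ (Sim-unique coh j s s″)) e″

  SameSets-sym : ∀ {j} → SameSets x x′ j → SameSets x′ x j
  SameSets-sym {j} (f , g) =
    (λ l → let (l′ , s) = g l in l′ , Sim-sym j s) , (λ l → let (l′ , s) = f l in l′ , Sim-sym j s)

  -- By covering, each set of level `j` is a member of some set of level `suc j`, so the lower
  -- family is the union of the upper one.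
  SameSets-pred : Covering x → Covering x′ → ∀ {j} → SameSets x x′ (suc j) → SameSets x x′ j
  SameSets-pred cov cov′ {j} (f , g) =
    (λ l → let (k , e) = cov j l ; (k′ , (p , _)) = f k ; (l′ , _ , s) = p l e in l′ , s) ,
    (λ l′ → let (k′ , e) = cov′ j l′ ; (k , (_ , q)) = g k′ ; (l , _ , s) = q l′ e in l , s)

  SameSets-≤ : Covering x → Covering x′ → ∀ {i j} → i ≤ j → SameSets x x′ j → SameSets x x′ i
  SameSets-≤ cov cov′ i≤j = go (≤⇒≤′ i≤j)
    where
    go : ∀ {i j} → i ≤′ j → SameSets x x′ j → SameSets x x′ i
    go ≤′-refl       e = e
    go (≤′-step i≤j) e = go i≤j (SameSets-pred cov cov′ e)

Sim-bit : ∀ {x x′} → Coherent x → Coherent x′ → ∀ j {k k′ l l′} →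
          Sim x x′ j k k′ → Sim x x′ (suc j) l l′ → x (suc j) l k ≡ x′ (suc j) l′ k′
Sim-bit coh coh′ j s t =
  ⇔→≡ (mk⇔ (Sim-bit⇒ coh′ j s t) (Sim-bit⇒ coh j (Sim-sym j s) (Sim-sym (suc j) t)))

-- Labels, rules and objects

-- The place (j , k) of a point x stands for the set a_j^{x,k}.

Place : Set
Place = ℕ × ℕ

Diagram : Set
Diagram = List (List (Bool × Bool))

-- Level and label of the other object, then the diagram between the two parameter lists.
Key : Set
Key = ℕ × ℕ × Diagram

-- The label of an object carries a rule, by which the object decides its
-- membership relation to all objects of smaller rank.  A table yields arbitrary
-- bits against finitely many objects; the other two rules make the label and
-- the top set of an object visible in its elements.

data Rule : Set where
  default : Rule
  query   : ℕ → Rule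
  table   : List (Key × Bool) → Rule

_≟ᵏ_ : (κ κ′ : Key) → Dec (κ ≡ κ′)
_≟ᵏ_ = ×-≡-dec _≟_ (×-≡-dec _≟_ (List-≡-dec (List-≡-dec (×-≡-dec _≟ᵇ_ _≟ᵇ_))))

find : Key → List (Key × Bool) → Bool
find κ []             = false
find κ ((κ′ , b) ∷ t) = if does (κ′ ≟ᵏ κ) then b else find κ t

find-applyUpTo : ∀ (key : ℕ → Key) (β : ℕ → Bool) {κ b} S →
  ∃[ s ] s < S × key s ≡ κ → (∀ s → s < S → key s ≡ κ → β s ≡ b) →
  find κ (applyUpTo (λ s → key s , β s) S) ≡ b
find-applyUpTo key β {κ} (suc S) (s , s< , e) unique with key 0 ≟ᵏ κ
... | yes e₀ = unique 0 (s≤s z≤n) e₀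
... | no ¬e₀ with s | s<
...   | zero  | _        = contradiction e ¬e₀
...   | suc s | s≤s s<S =
  find-applyUpTo (key ∘ suc) (β ∘ suc) S (s , s<S , e) (λ s s< → unique (suc s) (s≤s s<))

eval : Rule → Key → Bool → Bool
eval default   _           d = d
eval (query L) (_ , L′ , _) _ = does (L′ ≟ L)
eval (table t) κ           _ = find κ t

countable-Key : Countable Key
countable-Key = countable-× countable-ℕ (countable-× countable-ℕ
  (countable-List (countable-List (countable-× countable-Bool countable-Bool))))

countable-Rule : Countable Rule
countable-Rule = countable-image f onto
  (countable-× countable-ℕ (countable-× countable-ℕ (countable-List (countable-× countable-Key countable-Bool))))
  where
  f : ℕ × ℕ × List (Key × Bool) → Rule
  f (0 , _ , _) = default
  f (1 , L , _) = query L
  f (_ , _ , t) = table t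
  onto : ∀ r → ∃[ a ] f a ≡ r
  onto default   = (0 , 0 , []) , refl
  onto (query L) = (1 , L , []) , refl
  onto (table t) = (2 , 0 , t) , refl

abstract
  -- Rules themselves mention labels, so labels are natural numbers decoded by a surjection. Rank,
  -- rule and prefix can thus be chosen independently of each other.
  labels : Countable (ℕ × Rule × String)
  labels = countable-× countable-ℕ (countable-× countable-Rule (countable-List countable-Bool))

rank : ℕ → ℕ
rank L = proj₁ (proj₁ labels L)

rule : ℕ → Rule
rule L = proj₁ (proj₂ (proj₁ labels L))

prefix : ℕ → String
prefix L = proj₂ (proj₂ (proj₁ labels L))

labelled : ∀ n r σ → ∃[ L ] rank L ≡ n × rule L ≡ r × prefix L ≡ σ
labelled n r σ = let (L , e) = proj₂ labels (n , r , σ) in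
  L , cong proj₁ e , cong (proj₁ ∘ proj₂) e , cong (proj₂ ∘ proj₂) e

-- At level i, the top stands for the set a_i^{x,top}, and the places are clipped
-- to levels at most i.

record Object : Set where
  constructor object
  field
    top    : ℕ
    places : List Place
    label  : ℕ

open Object

countable-Object : Countable Object
countable-Object = countable-image (λ (t , p , L) → object t p L) (λ (object t p L) → (t , p , L) , refl)
  (countable-× countable-ℕ (countable-× (countable-List (countable-× countable-ℕ countable-ℕ)) countable-ℕ))

-- Clipping, instead of a bound in the type, lets one countable type of objects serve all levels.
clip : ℕ → Place → Place
clip i (j , k) = j ⊓ i , k

params : ℕ → Object → List Place
params i o = (i , top o) ∷ map (clip i) (places o)

params-level : ∀ i o → All (λ ν → proj₁ ν ≤ i) (params i o)
params-level i o = ≤-refl ∷ go (places o)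
  where
  go : ∀ ps → All (λ ν → proj₁ ν ≤ i) (map (clip i) ps)
  go []             = []
  go ((j , k) ∷ ps) = m⊓n≤n j i ∷ go ps

∈-params : ∀ {i o ν} → ν ∈ₗ places o → proj₁ ν ≤ i → ν ∈ₗ params i o
∈-params {i} {o} {j , k} ν∈ j≤i =
  there (subst (λ j′ → (j′ , k) ∈ₗ map (clip i) (places o)) (m≤n⇒m⊓n≡m j≤i) (∈-map⁺ (clip i) ν∈))

record EqPlace (x : W) (μ ν : Place) : Set where
  constructor eqPlace
  field
    level : proj₁ μ ≡ proj₁ ν
    row   : x (proj₁ μ) (proj₂ μ) ≗ x (proj₁ ν) (proj₂ ν)

MemPlace : W → Place → Place → Set
MemPlace x μ ν = suc (proj₁ μ) ≡ proj₁ ν × x (proj₁ ν) (proj₂ ν) (proj₂ μ) ≡ true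

SimPlace : W → W → Place → Place → Set
SimPlace x x′ μ ν = proj₁ μ ≡ proj₁ ν × Sim x x′ (proj₁ μ) (proj₂ μ) (proj₂ ν)

EqPlace-refl : ∀ {x μ} → EqPlace x μ μ
EqPlace-refl = eqPlace refl (λ _ → refl)

EqPlace-sym : ∀ {x μ ν} → EqPlace x μ ν → EqPlace x ν μ
EqPlace-sym (eqPlace refl e) = eqPlace refl (λ m → sym (e m))

EqPlace⇒SimPlace : ∀ {x μ ν} → EqPlace x μ ν → SimPlace x x μ ν
EqPlace⇒SimPlace {μ = j , k} (eqPlace refl e) = refl , Sim-extʳ j e (Sim-refl j k)

record EqObject (x : W) (i : ℕ) (o o′ : Object) : Set where
  constructor eqObject
  field
    eq-label  : label o ≡ label o′
    eq-params : Pointwise (EqPlace x) (params i o) (params i o′)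

record Match (x x′ : W) (i : ℕ) (o o′ : Object) : Set where
  constructor match
  field
    match-label  : label o ≡ label o′
    match-params : Pointwise (SimPlace x x′) (params i o) (params i o′)

open EqObject

EqObject-refl : ∀ {x i o} → EqObject x i o o
EqObject-refl = eqObject refl (Pw.refl EqPlace-refl)

EqObject-sym : ∀ {x i o o′} → EqObject x i o o′ → EqObject x i o′ o
EqObject-sym (eqObject e p) = eqObject (sym e) (Pw.symmetric EqPlace-sym p)

EqObject⇒Match : ∀ {x i o o′} → EqObject x i o o′ → Match x x i o o′
EqObject⇒Match (eqObject e p) = match e (Pw.map EqPlace⇒SimPlace p)

Match-top : ∀ {x x′ i o o′} → Match x x′ i o o′ → Sim x x′ i (top o) (top o′)
Match-top (match _ ((_ , s) ∷ _)) = s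

Match-ext : ∀ {x x′ i o o′ o″} → Match x x′ i o o′ → EqObject x′ i o″ o′ → Match x x′ i o o″
Match-ext {x} {x′} (match e p) (eqObject e′ p′) = match (trans e (sym e′)) (go p p′)
  where
  go : ∀ {ps qs rs} → Pointwise (SimPlace x x′) ps qs → Pointwise (EqPlace x′) rs qs →
       Pointwise (SimPlace x x′) ps rs
  go []                   []                 = []
  go {(j , _) ∷ _} ((refl , s) ∷ ss) (eqPlace refl q ∷ qs) = (refl , Sim-extʳ j (λ m → sym (q m)) s) ∷ go ss qs

-- Invariant membership and the extension property

module Objects (em : ExcludedMiddle 0ℓ) where
  open Classical em

  entry : W → Place → Place → Bool × Bool
  entry x μ ν = truth (EqPlace x μ ν) , truth (MemPlace x μ ν)

  diagram : W → List Place → List Place → Diagram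
  diagram x ps qs = map (λ μ → map (entry x μ) qs) ps

  -- Exactly one of the two rules is consulted, that of larger rank or of the container `O` on a
  -- tie, so two tables never conflict.
  Mem : W → ℕ → Object → Object → Bool
  Mem x i o O =
    if does (rank (label O) <? rank (label o))
    then eval (rule (label o)) (suc i , label O , diagram x (params i o) (params (suc i) O)) (x (suc i) (top O) (top o))
    else eval (rule (label O)) (i , label o , diagram x (params i o) (params (suc i) O)) (x (suc i) (top O) (top o))

  Mem-member : ∀ x i {o O} → rank (label O) < rank (label o) →
    Mem x i o O ≡ eval (rule (label o)) (suc i , label O , diagram x (params i o) (params (suc i) O))
                       (x (suc i) (top O) (top o))
  Mem-member x i {o} {O} lt rewrite dec-true (rank (label O) <? rank (label o)) lt = refl

  Mem-set : ∀ x i {o O} → rank (label o) ≤ rank (label O) →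
    Mem x i o O ≡ eval (rule (label O)) (i , label o , diagram x (params i o) (params (suc i) O))
                       (x (suc i) (top O) (top o))
  Mem-set x i {o} {O} le rewrite dec-false (rank (label O) <? rank (label o)) (≤⇒≯ le) = refl

  entry-cong : ∀ {x x′ μ μ′ ν ν′} → Coherent x → Coherent x′ →
    SimPlace x x′ μ μ′ → SimPlace x x′ ν ν′ → entry x μ ν ≡ entry x′ μ′ ν′
  entry-cong {x} {x′} {μ} {μ′} {ν} {ν′} coh coh′ (refl , s) (refl , t) = cong₂ _,_
    (truth-cong
      (λ { (eqPlace refl e) → eqPlace refl (Sim-unique coh′ (proj₁ μ) s (Sim-extˡ (proj₁ μ) e t)) })
      (λ { (eqPlace refl e) → eqPlace refl
           (Sim-unique coh (proj₁ μ) (Sim-sym (proj₁ μ) s) (Sim-extˡ (proj₁ μ) e (Sim-sym (proj₁ μ) t))) }))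
    (truth-cong
      (λ { (refl , e) → refl , trans (sym (Sim-bit coh coh′ (proj₁ μ) s t)) e })
      (λ { (refl , e) → refl , trans (Sim-bit coh coh′ (proj₁ μ) s t) e }))

  diagram-cong : ∀ {x x′ ps ps′ qs qs′} → Coherent x → Coherent x′ →
    Pointwise (SimPlace x x′) ps ps′ → Pointwise (SimPlace x x′) qs qs′ →
    diagram x ps qs ≡ diagram x′ ps′ qs′
  diagram-cong coh coh′ [] _ = refl
  diagram-cong {x} {x′} {μ ∷ _} {μ′ ∷ _} coh coh′ (s ∷ ss) ts =
    cong₂ _∷_ (row ts) (diagram-cong coh coh′ ss ts)
    where
    row : ∀ {qs qs′} → Pointwise (SimPlace x x′) qs qs′ → map (entry x μ) qs ≡ map (entry x′ μ′) qs′
    row []       = refl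
    row (t ∷ ts) = cong₂ _∷_ (entry-cong coh coh′ s t) (row ts)

  -- All that `Mem` consults is determined by the sets behind the places: labels, diagrams and, by
  -- coherence, the membership between the tops.
  Mem-cong : ∀ {x x′ i o o′ O O′} → Coherent x → Coherent x′ →
    Match x x′ i o o′ → Match x x′ (suc i) O O′ → Mem x i o O ≡ Mem x′ i o′ O′
  Mem-cong {x} {x′} {i} coh coh′ m@(match refl p) M@(match refl q)
    rewrite diagram-cong coh coh′ p q | Sim-bit coh coh′ i (Match-top m) (Match-top M) = refl

  map-≡-at : ∀ {f g : I → K} {as a} → map f as ≡ map g as → a ∈ₗ as → f a ≡ g a
  map-≡-at e (here refl) = proj₁ (∷-injective e)
  map-≡-at e (there a∈)  = map-≡-at (proj₂ (∷-injective e)) a∈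

  entry-eq : ∀ {x μ ν} → entry x μ μ ≡ entry x μ ν → EqPlace x μ ν
  entry-eq e = truth⇒ (trans (sym (cong proj₁ e)) (truth-yes EqPlace-refl))

  entry-eq′ : ∀ {x μ ν} → entry x μ μ ≡ entry x ν μ → EqPlace x ν μ
  entry-eq′ e = truth⇒ (trans (sym (cong proj₁ e)) (truth-yes EqPlace-refl))

  -- Each place of `ps` also heads a column, and its entry there records equality with itself; the
  -- same entry in the other diagram yields an equal place.
  diagram-rows : ∀ {x qs} ps ps′ → diagram x ps qs ≡ diagram x ps′ qs → (∀ ν → ν ∈ₗ ps → ν ∈ₗ qs) →
                 Pointwise (EqPlace x) ps ps′
  diagram-rows []       []         _ _   = []
  diagram-rows (ν ∷ ps) (ν′ ∷ ps′) e ps⊆ =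
    EqPlace-sym (entry-eq′ (map-≡-at (proj₁ (∷-injective e)) (ps⊆ ν (here refl)))) ∷
    diagram-rows ps ps′ (proj₂ (∷-injective e)) (λ μ μ∈ → ps⊆ μ (there μ∈))

  -- Columns may have a level that no row has, where equality with a row identifies nothing; hence
  -- the separation hypothesis. The guaranteed row `μ₀` makes both lists equally long.
  diagram-columns : ∀ {x μ₀ ps} qs qs′ → diagram x (μ₀ ∷ ps) qs ≡ diagram x (μ₀ ∷ ps) qs′ →
    (∀ ν ν′ → ν ∈ₗ qs → ν′ ∈ₗ qs′ → (∀ μ → μ ∈ₗ μ₀ ∷ ps → entry x μ ν ≡ entry x μ ν′) → EqPlace x ν ν′) →
    Pointwise (EqPlace x) qs qs′
  diagram-columns {x} {μ₀} {ps} qs qs′ e separated =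
    go qs qs′ (λ μ μ∈ → map-≡-at e μ∈) separated
    where
    go : ∀ qs qs′ → (∀ μ → μ ∈ₗ μ₀ ∷ ps → map (entry x μ) qs ≡ map (entry x μ) qs′) →
         (∀ ν ν′ → ν ∈ₗ qs → ν′ ∈ₗ qs′ → (∀ μ → μ ∈ₗ μ₀ ∷ ps → entry x μ ν ≡ entry x μ ν′) → EqPlace x ν ν′) →
         Pointwise (EqPlace x) qs qs′
    go []       []         _ _   = []
    go []       (_ ∷ _)    e _   with () ← e μ₀ (here refl)
    go (_ ∷ _)  []         e _   with () ← e μ₀ (here refl)
    go (ν ∷ qs) (ν′ ∷ qs′) e sep =
      sep ν ν′ (here refl) (here refl) (λ μ μ∈ → proj₁ (∷-injective (e μ μ∈))) ∷
      go qs qs′ (λ μ μ∈ → proj₂ (∷-injective (e μ μ∈))) (λ ν ν′ ν∈ ν′∈ → sep ν ν′ (there ν∈) (there ν′∈))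

  -- A new object of level i can be given any bits against finitely many
  -- distinct objects: the diagram of its parameters, which include all given
  -- parameters and points separating them, identifies each given object with
  -- a given label, so that a table with larger rank can list the bits.

  module Extension (x : W) (i S : ℕ) (ob : ℕ → Object) (lv : ℕ → ℕ) where

    private
      pool : List Place
      pool = concat (applyUpTo (λ s → params (lv s) (ob s)) S)

      ∈-pool : ∀ {s ν} → s < S → ν ∈ₗ params (lv s) (ob s) → ν ∈ₗ pool
      ∈-pool s< ν∈ = ∈-concat⁺′ ν∈ (∈-applyUpTo⁺ (λ s → params (lv s) (ob s)) s<)

      Separator : Place → Place → ℕ → Set
      Separator (j , k) (j′ , k′) l = x j k l ≢ x j′ k′ l

      -- If two rows of level `suc i` differ in column `l`, then `(i , l)` stands for a set
      -- belonging to exactly one of theirs; `(i , 0)` is a dummy for equal rows.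
      point : ∀ μ ν → Dec (∃[ l ] Separator μ ν l) → Place
      point μ ν (yes (l , _)) = i , l
      point μ ν (no _)        = i , 0

      points : List Place
      points = cartesianProductWith (λ μ ν → point μ ν em) pool pool

      newPlaces : List Place
      newPlaces = pool ++ points

      newParams : List Place
      newParams = params i (object 0 newPlaces 0)

      pool⊆ : ∀ {s ν} → s < S → ν ∈ₗ params (lv s) (ob s) → proj₁ ν ≤ i → ν ∈ₗ newParams
      pool⊆ s< ν∈ = ∈-params {i} {object 0 newPlaces 0} (∈-++⁺ˡ (∈-pool s< ν∈))

      -- Places of level at most `i` are among the new parameters and recognised by equality; those
      -- of level `suc i` cannot be and are told apart by the points.
      separated : ∀ {s s′} → s < S → s′ < S → lv s ≡ suc i → lv s′ ≡ suc i → ∀ ν ν′ →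
        ν ∈ₗ params (lv s) (ob s) → ν′ ∈ₗ params (lv s′) (ob s′) →
        (∀ μ → μ ∈ₗ newParams → entry x μ ν ≡ entry x μ ν′) → EqPlace x ν ν′
      separated {s} {s′} s< s′< e e′ ν ν′ ν∈ ν′∈ same with proj₁ ν ≤? i | proj₁ ν′ ≤? i
      ... | yes ν≤i | _        = entry-eq (same ν (pool⊆ s< ν∈ ν≤i))
      ... | no _    | yes ν′≤i = EqPlace-sym (entry-eq (sym (same ν′ (pool⊆ s′< ν′∈ ν′≤i))))
      ... | no ν≰i  | no ν′≰i  = eqPlace (trans (level e ν∈ ν≰i) (sym (level e′ ν′∈ ν′≰i))) rows
        where
        level : ∀ {s ν} → lv s ≡ suc i → ν ∈ₗ params (lv s) (ob s) → ¬ (proj₁ ν ≤ i) → proj₁ ν ≡ suc i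
        level {s} {ν} e ν∈ ν≰i =
          ≤-antisym (subst (proj₁ ν ≤_) e (All.lookup (params-level (lv s) (ob s)) ν∈)) (≰⇒> ν≰i)
        point∈ : (d : Dec (∃[ l ] Separator ν ν′ l)) → em ≡ d → point ν ν′ d ∈ₗ newParams
        point∈ d refl = ∈-params {i} {object 0 newPlaces 0} (∈-++⁺ʳ pool
          (∈-cartesianProductWith⁺ (λ μ ν → point μ ν em) (∈-pool s< ν∈) (∈-pool s′< ν′∈)))
          (≤-reflexive (level≡ em))
          where
          level≡ : ∀ d → proj₁ (point ν ν′ d) ≡ i
          level≡ (yes _) = refl
          level≡ (no _)  = refl
        rows : x (proj₁ ν) (proj₂ ν) ≗ x (proj₁ ν′) (proj₂ ν′)
        rows l = go em refl
          where
          go : (d : Dec (∃[ l ] Separator ν ν′ l)) → em ≡ d → _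
          go (no none) _ = dne λ ≢ → none (l , ≢)
          go (yes (l , ≢)) d≡ = contradiction
            (⇔→≡ (mk⇔ (bit⇒ (level e ν∈ ν≰i) (level e′ ν′∈ ν′≰i) (same (i , l) (point∈ _ d≡)))
                      (bit⇒ (level e′ ν′∈ ν′≰i) (level e ν∈ ν≰i) (sym (same (i , l) (point∈ _ d≡)))))) ≢
            where
            bit⇒ : ∀ {ν ν′ : Place} → proj₁ ν ≡ suc i → proj₁ ν′ ≡ suc i →
                   entry x (i , l) ν ≡ entry x (i , l) ν′ →
                   x (proj₁ ν) (proj₂ ν) l ≡ true → x (proj₁ ν′) (proj₂ ν′) l ≡ true
            bit⇒ p q eq b = proj₂ (truth⇒ (trans (sym (cong proj₂ eq)) (truth-yes (sym p , b))))

      -- As in `Mem`, rows belong to the member and columns to the container; the new object is the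
      -- member exactly against level `suc i`.
      diagramWith : ∀ s → Dec (lv s ≡ suc i) → Diagram
      diagramWith s (yes _) = diagram x newParams (params (lv s) (ob s))
      diagramWith s (no _)  = diagram x (params (lv s) (ob s)) newParams

      key : ℕ → Key
      key s = lv s , label (ob s) , diagramWith s (lv s ≟ suc i)

      key-above : ∀ {s} → lv s ≡ suc i → key s ≡ (lv s , label (ob s) , diagram x newParams (params (lv s) (ob s)))
      key-above {s} e with lv s ≟ suc i
      ... | yes _ = refl
      ... | no ¬e = contradiction e ¬e

      key-below : ∀ {s} → suc (lv s) ≡ i → key s ≡ (lv s , label (ob s) , diagram x (params (lv s) (ob s)) newParams)
      key-below {s} e with lv s ≟ suc i
      ... | no _   = refl
      ... | yes e′ = contradiction (trans (sym (cong suc e′)) e) (λ ())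

    module _ (distinct : ∀ s s′ → s < S → s′ < S → lv s ≡ lv s′ → EqObject x (lv s) (ob s) (ob s′) → s ≡ s′)
             (β : ℕ → Bool) (σ : String) where

      private
        key-injective : ∀ {s s′} → s < S → s′ < S → lv s ≡ suc i ⊎ suc (lv s) ≡ i → key s ≡ key s′ → s ≡ s′
        key-injective {s} {s′} s< s′< (inj₁ e) k =
          distinct s s′ s< s′< lv≡ (eqObject (cong (proj₁ ∘ proj₂) k)
            (subst (λ j → Pointwise (EqPlace x) (params (lv s) (ob s)) (params j (ob s′))) (sym lv≡)
              (diagram-columns _ _ (cong (proj₂ ∘ proj₂)
                (trans (sym (key-above e)) (trans k (key-above e′)))) (separated s< s′< e e′))))
          where
          lv≡ = cong proj₁ k
          e′ = trans (sym lv≡) e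
        key-injective {s} {s′} s< s′< (inj₂ e) k =
          distinct s s′ s< s′< lv≡ (eqObject (cong (proj₁ ∘ proj₂) k)
            (subst (λ j → Pointwise (EqPlace x) (params (lv s) (ob s)) (params j (ob s′))) (sym lv≡)
              (diagram-rows _ _ (cong (proj₂ ∘ proj₂)
                (trans (sym (key-below e)) (trans k (key-below (trans (cong suc (sym lv≡)) e)))))
                (λ ν ν∈ → pool⊆ s< ν∈ (≤-trans (All.lookup (params-level (lv s) (ob s)) ν∈)
                                                (≤-trans (n≤1+n _) (≤-reflexive e)))))))
          where
          lv≡ = cong proj₁ k

        newTable : List (Key × Bool)
        newTable = applyUpTo (λ s → key s , β s) S

        newRank : ∃[ r ] (∀ s → s < S → rank (label (ob s)) < r)
        newRank = bounded (rank ∘ label ∘ ob) S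

        newLabel : ∃[ L ] rank L ≡ proj₁ newRank × rule L ≡ table newTable × prefix L ≡ σ
        newLabel = labelled (proj₁ newRank) (table newTable) σ

        new : Object
        new = object 0 newPlaces (proj₁ newLabel)

        found : ∀ {s} → s < S → lv s ≡ suc i ⊎ suc (lv s) ≡ i → ∀ d →
                eval (rule (label new)) (key s) d ≡ β s
        found {s} s< near d rewrite proj₁ (proj₂ (proj₂ newLabel)) =
          find-applyUpTo key β S (s , s< , refl)
            (λ s′ s′< e → cong β (sym (key-injective s< s′< near (sym e))))

      extend : ∃[ o ] prefix (label o) ≡ σ ×
        (∀ s → s < S → rank (label (ob s)) < rank (label o)) ×
        (∀ s → s < S → lv s ≡ suc i → Mem x i o (ob s) ≡ β s) ×
        (∀ s → s < S → suc (lv s) ≡ i → Mem x (lv s) (ob s) o ≡ β s)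
      extend = new , proj₂ (proj₂ (proj₂ newLabel)) , rank< , above , below
        where
        rank< : ∀ s → s < S → rank (label (ob s)) < rank (label new)
        rank< s s< = subst (rank (label (ob s)) <_) (sym (proj₁ (proj₂ newLabel))) (proj₂ newRank s s<)
        above : ∀ s → s < S → lv s ≡ suc i → Mem x i new (ob s) ≡ β s
        above s s< e = trans (Mem-member x i (rank< s s<)) (trans
          (cong (λ κ → eval (rule (label new)) κ (x (suc i) (top (ob s)) 0))
            (trans (cong (λ j → j , label (ob s) , diagram x newParams (params j (ob s))) (sym e))
                   (sym (key-above e))))
          (found s< (inj₁ e) _))
        below : ∀ s → s < S → suc (lv s) ≡ i → Mem x (lv s) (ob s) new ≡ β s
        below s s< e = trans (Mem-set x (lv s) {ob s} {new} (<⇒≤ (rank< s s<))) (trans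
          (cong (λ κ → eval (rule (label new)) κ (x (suc (lv s)) 0 (top (ob s))))
            (trans (cong (λ j → lv s , label (ob s) , diagram x (params (lv s) (ob s)) (params j new)) e)
                   (sym (key-below e))))
          (found s< (inj₂ e) _))

_‼_ : List Object → ℕ → Object
_‼_ = nth (object 0 [] 0)

-- The generic enumeration of all objects

module Construction (em : ExcludedMiddle 0ℓ) (D : ℕ → String → Set) (dense : DenseFamily D) where
  open Classical em
  open Objects em
  open Fusion em D dense prefix

  index : W → Object → Index
  index x o = label o , map (λ ν → x (proj₁ ν) (proj₂ ν)) (params 0 o)

  Match⇒≋ : ∀ {x x′ o o′} → Match x x′ 0 o o′ → index x o ≋ index x′ o′
  Match⇒≋ {x} {x′} {o} {o′} (match e p) s =
    cong₂ _,_ e (go (params-level 0 o) p)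
    where
    row : W → Place → ℕ → Bool
    row x ν = x (proj₁ ν) (proj₂ ν)
    go : ∀ {ps qs} → All (λ ν → proj₁ ν ≤ 0) ps → Pointwise (SimPlace x x′) ps qs →
         map (trunc s) (map (row x) ps) ≡ map (trunc s) (map (row x′) qs)
    go []         []                   = refl
    go (z≤n ∷ ls) ((refl , eq) ∷ eqs) = cong₂ _∷_ (applyUpTo-cong eq s) (go ls eqs)
      where
      applyUpTo-cong : ∀ {f g : ℕ → Bool} → f ≗ g → ∀ n → applyUpTo f n ≡ applyUpTo g n
      applyUpTo-cong f≗g zero    = refl
      applyUpTo-cong f≗g (suc n) = cong₂ _∷_ (f≗g 0) (applyUpTo-cong (f≗g ∘ suc) n)

  trunc-injective : ∀ {f g : ℕ → Bool} → (∀ s → trunc s f ≡ trunc s g) → f ≗ g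
  trunc-injective {f} {g} e m =
    trans (sym (nth-applyUpTo f (n<1+n m))) (trans (cong (λ σ → at σ m) (e (suc m))) (nth-applyUpTo g (n<1+n m)))

  ≋⇒EqObject : ∀ {x o o′} → index x o ≋ index x o′ → EqObject x 0 o o′
  ≋⇒EqObject {x} {o} {o′} eq = eqObject (cong proj₁ (eq 0))
    (go (params 0 o) (params 0 o′) (params-level 0 o) (params-level 0 o′) (λ s → cong proj₂ (eq s)))
    where
    row : Place → ℕ → Bool
    row ν = x (proj₁ ν) (proj₂ ν)
    go : ∀ ps qs → All (λ ν → proj₁ ν ≤ 0) ps → All (λ ν → proj₁ ν ≤ 0) qs →
         (∀ s → map (trunc s) (map row ps) ≡ map (trunc s) (map row qs)) → Pointwise (EqPlace x) ps qs
    go []       []       _          _          _ = []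
    go []       (_ ∷ _)  _          _          e with () ← e 0
    go (_ ∷ _)  []       _          _          e with () ← e 0
    go (_ ∷ ps) (_ ∷ qs) (l ∷ ls) (l′ ∷ ls′) e =
      eqPlace (trans (n≤0⇒n≡0 l) (sym (n≤0⇒n≡0 l′))) (trunc-injective (λ s → proj₁ (∷-injective (e s)))) ∷
      go ps qs ls ls′ (λ s → proj₂ (∷-injective (e s)))

  image : W → (ℕ → Object) → W
  image x e zero    k m = ρ (index x (e (pair 0 k))) m
  image x e (suc i) k m = Mem x i (e (pair i m)) (e (pair (suc i) k))

  -- The object in slot pair i k has level i and becomes the k-th of its level.

  Decided : ℕ → ℕ → ℕ → ℕ → Set
  Decided S zero    k m = pair 0 k < S
  Decided S (suc i) k m = pair i m < S × pair (suc i) k < S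

  image-cong : ∀ x {e e′ S} → (∀ s → s < S → e s ≡ e′ s) → ∀ i k m → Decided S i k m →
               image x e i k m ≡ image x e′ i k m
  image-cong x eq zero    k m s<        = cong (λ o → ρ (index x o) m) (eq _ s<)
  image-cong x eq (suc i) k m (s< , s′<) = cong₂ (Mem x i) (eq _ s<) (eq _ s′<)

  Decided-mono : ∀ {S S′} → S ≤ S′ → ∀ i k m → Decided S i k m → Decided S′ i k m
  Decided-mono S≤ zero    k m s<         = <-≤-trans s< S≤
  Decided-mono S≤ (suc i) k m (s< , s′<) = <-≤-trans s< S≤ , <-≤-trans s′< S≤

  State : Set
  State = List Object

  Distinct : W → State → Set
  Distinct x st = ∀ i k k′ → pair i k < length st → pair i k′ < length st →
                  EqObject x i (st ‼ pair i k) (st ‼ pair i k′) → k ≡ k′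

  Fits : W → State → String → Set
  Fits x st σ = ∀ i k m → code i k m < length σ → Decided (length st) i k m →
                image x (st ‼_) i k m ≡ at σ (code i k m)

  -- `Fits` is the invariant while a state grows towards `σ`; `Agrees` is reached once all bits of
  -- `σ` are determined, and no later object can disturb it.
  Agrees : W → State → String → Set
  Agrees x st σ = ∀ i k m → code i k m < length σ →
                  Decided (length st) i k m × image x (st ‼_) i k m ≡ at σ (code i k m)

  Listed : W → State → ℕ × Object → Set
  Listed x st (i , o) = ∃[ k ] pair i k < length st × EqObject x i (st ‼ pair i k) o

  abstract
    tasks : Countable (ℕ × Object)
    tasks = countable-× countable-ℕ countable-Object

    blocks : Countable State
    blocks = countable-List countable-Object

  Step : W → ℕ → State → State → Set
  Step x t st ext =
    Distinct x (st ++ ext) ×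
    (∃[ σ ] D t σ × Agrees x (st ++ ext) σ) ×
    Listed x (st ++ ext) (proj₁ tasks t) ×
    t < length (st ++ ext)

  private
    pair-injective : ∀ {i k j l} → pair i k ≡ pair j l → (i , k) ≡ (j , l)
    pair-injective {i} {k} {j} {l} e =
      trans (sym (unpair-pair i k)) (trans (cong unpair e) (unpair-pair j l))

    ‼-++ : ∀ st ext s → s < length st → st ‼ s ≡ (st ++ ext) ‼ s
    ‼-++ st ext s s< = sym (nth-++ st s<)

    length-≤ : ∀ (st ext : State) → length st ≤ length (st ++ ext)
    length-≤ st ext = subst (length st ≤_) (sym (length-++ st)) (m≤m+n _ _)

    split : ∀ (st : State) {o s} → s < length (st ++ o ∷ []) → s < length st ⊎ s ≡ length st
    split st {o} s< = m≤n⇒m<n∨m≡n (s≤s⁻¹ (subst (_ <_) (trans (length-++ st) (+-comm (length st) 1)) s<))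

    Agrees-++ : ∀ {x st σ} ext → Agrees x st σ → Agrees x (st ++ ext) σ
    Agrees-++ {x} {st} ext agr i k m c< = let (d , e) = agr i k m c< in
      Decided-mono (length-≤ st ext) i k m d , trans (sym (image-cong x (‼-++ st ext) i k m d)) e

    Distinct-snoc : ∀ {x st} o → Distinct x st →
      (∀ i k k′ → pair i k ≡ length st → pair i k′ < length st → ¬ EqObject x i (st ‼ pair i k′) o) →
      Distinct x (st ++ o ∷ [])
    Distinct-snoc {x} {st} o dis new i k k′ s< s′< eq with split st s< | split st s′<
    ... | inj₁ s<  | inj₁ s′< = dis i k k′ s< s′<
      (subst₂ (EqObject x i) (sym (‼-++ st _ _ s<)) (sym (‼-++ st _ _ s′<)) eq)
    ... | inj₁ s<  | inj₂ s′≡ = contradiction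
      (subst₂ (EqObject x i) (sym (‼-++ st _ _ s<)) (trans (cong ((st ++ o ∷ []) ‼_) s′≡) (nth-length st)) eq)
      (new i k′ k s′≡ s<)
    ... | inj₂ s≡  | inj₁ s′< = contradiction
      (EqObject-sym (subst₂ (EqObject x i) (trans (cong ((st ++ o ∷ []) ‼_) s≡) (nth-length st))
                                           (sym (‼-++ st _ _ s′<)) eq))
      (new i k k′ s≡ s′<)
    ... | inj₂ s≡  | inj₂ s′≡ = cong proj₂ (pair-injective {i} {k} {i} {k′} (trans s≡ (sym s′≡)))

  -- The string `σ` dictates the next object: its bits against earlier slots become the table, and
  -- row `k` of level 0 the prefix of the real. Past the end of `σ` the default `false` serves.
  module Snoc (x : W) (st : State) (σ : String) (dis : Distinct x st) (fits : Fits x st σ) where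
    private
      S i k : ℕ
      S = length st
      i = proj₁ (unpair S)
      k = proj₂ (unpair S)

      lv column : ℕ → ℕ
      lv s     = proj₁ (unpair s)
      column s = proj₂ (unpair s)

      dis′ : ∀ s s′ → s < S → s′ < S → lv s ≡ lv s′ → EqObject x (lv s) (st ‼ s) (st ‼ s′) → s ≡ s′
      dis′ s s′ s< s′< lv≡ eq =
        trans (sym (pair-unpair s)) (trans (cong₂ pair lv≡ col≡) (pair-unpair s′))
        where
        pair≡ : pair (lv s) (column s′) ≡ s′
        pair≡ = trans (cong (λ j → pair j (column s′)) lv≡) (pair-unpair s′)
        col≡ : column s ≡ column s′
        col≡ = dis (lv s) (column s) (column s′)
          (subst (_< S) (sym (pair-unpair s)) s<) (subst (_< S) (sym pair≡) s′<)
          (subst₂ (EqObject x (lv s)) (cong (st ‼_) (sym (pair-unpair s))) (cong (st ‼_) (sym pair≡)) eq)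

      bitAt : ∀ s → Dec (lv s ≡ suc i) → Bool
      bitAt s (yes _) = at σ (code (suc i) (column s) k)
      bitAt s (no _)  = at σ (code i k (column s))

      β : ℕ → Bool
      β s = bitAt s (lv s ≟ suc i)

      β-above : ∀ k′ → β (pair (suc i) k′) ≡ at σ (code (suc i) k′ k)
      β-above k′ with lv (pair (suc i) k′) ≟ suc i
      ... | yes _ = cong (λ c → at σ (code (suc i) c k)) (cong proj₂ (unpair-pair (suc i) k′))
      ... | no ≢  = contradiction (cong proj₁ (unpair-pair (suc i) k′)) ≢

      β-below : ∀ i′ m → suc i′ ≡ i → β (pair i′ m) ≡ at σ (code i k m)
      β-below i′ m e with lv (pair i′ m) ≟ suc i
      ... | no _  = cong (λ c → at σ (code i k c)) (cong proj₂ (unpair-pair i′ m))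
      ... | yes p = contradiction
        (trans (sym (cong proj₁ (unpair-pair i′ m))) (trans p (cong suc (sym e)))) (λ ())

      rowString : String
      rowString = applyUpTo (λ m → at σ (code 0 k m)) (length σ)

      extension = Extension.extend x i S (st ‼_) lv dis′ β rowString

    o : Object
    o = proj₁ extension

    private
      member : ∀ k′ → pair (suc i) k′ < S → Mem x i o (st ‼ pair (suc i) k′) ≡ at σ (code (suc i) k′ k)
      member k′ s< = trans
        (proj₁ (proj₂ (proj₂ (proj₂ extension))) _ s< (cong proj₁ (unpair-pair (suc i) k′))) (β-above k′)

      container : ∀ i′ m → suc i′ ≡ i → pair i′ m < S → Mem x i′ (st ‼ pair i′ m) o ≡ at σ (code i k m)
      container i′ m e s< = trans (cong (λ j → Mem x j (st ‼ pair i′ m) o) (sym lv≡))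
        (trans (proj₂ (proj₂ (proj₂ (proj₂ extension))) _ s< (trans (cong suc lv≡) e)) (β-below i′ m e))
        where
        lv≡ : lv (pair i′ m) ≡ i′
        lv≡ = cong proj₁ (unpair-pair i′ m)

      real : ∀ m → m < length σ → ρ (index x o) m ≡ at σ (code 0 k m)
      real m m< = trans
        (ρ-str (index x o) m (subst (m <_) (sym (trans (cong length prefix≡) (length-applyUpTo _ (length σ)))) m<))
        (trans (cong (λ τ → at τ m) prefix≡) (nth-applyUpTo (λ m → at σ (code 0 k m)) m<))
        where
        prefix≡ : prefix (label o) ≡ rowString
        prefix≡ = proj₁ (proj₂ extension)

    distinct : Distinct x (st ++ o ∷ [])
    -- The new rank exceeds all old ones, so the new label differs from every old label.
    distinct = Distinct-snoc {x} {st} o dis λ j l l′ _ s′< eq → <-irrefl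
      (cong rank (eq-label eq)) (proj₁ (proj₂ (proj₂ extension)) _ s′<)

    private
      old : ∀ {s} → s < S → (st ++ o ∷ []) ‼ s ≡ st ‼ s
      old s< = sym (‼-++ st _ _ s<)

      latest : ∀ {s} → s ≡ S → (st ++ o ∷ []) ‼ s ≡ o
      latest s≡ = trans (cong ((st ++ o ∷ []) ‼_) s≡) (nth-length st)

      slot : ∀ {j l} → pair j l ≡ S → (j , l) ≡ (i , k)
      slot {j} {l} e = trans (sym (unpair-pair j l)) (cong unpair e)

    fits′ : Fits x (st ++ o ∷ []) σ
    fits′ zero l m c< s< with split st s<
    ... | inj₁ s< = trans (cong (λ o → ρ (index x o) m) (old s<)) (fits 0 l m c< s<)
    ... | inj₂ s≡ = trans (cong (λ o → ρ (index x o) m) (latest s≡)) (trans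
      (real m (≤-<-trans (place≤code 0 l m) c<))
      (cong (λ l → at σ (code 0 l m)) (sym (cong proj₂ (slot s≡)))))
    fits′ (suc j) l m c< (s< , s′<) with split st s< | split st s′<
    ... | inj₁ s< | inj₁ s′< = trans (cong₂ (Mem x j) (old s<) (old s′<)) (fits (suc j) l m c< (s< , s′<))
    ... | inj₁ s< | inj₂ s′≡ = trans (cong₂ (Mem x j) (old s<) (latest s′≡)) (trans
      (container j m (cong proj₁ (slot s′≡)) s<)
      (cong (λ (j , l) → at σ (code j l m)) (sym (slot s′≡))))
    ... | inj₂ s≡ | inj₁ s′< = trans (cong₂ (Mem x j) (latest s≡) (old s′<)) (go (slot s≡) s′<)
      where
      go : (j , m) ≡ (i , k) → pair (suc j) l < S → Mem x j o (st ‼ pair (suc j) l) ≡ at σ (code (suc j) l m)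
      go refl s′< = member l s′<
    -- One slot cannot have both level `j` and level `suc j`.
    ... | inj₂ s≡ | inj₂ s′≡ = contradiction
      (cong proj₁ (trans (slot {suc j} {l} s′≡) (sym (slot {j} {m} s≡)))) (λ ())

  grow : ∀ x σ n st → Distinct x st → Fits x st σ →
         ∃[ ext ] length (st ++ ext) ≡ length st + n × Distinct x (st ++ ext) × Fits x (st ++ ext) σ
  grow x σ zero st dis fits =
    [] , trans (cong length (++-identityʳ st)) (sym (+-identityʳ _)) ,
    subst (Distinct x) (sym (++-identityʳ st)) dis ,
    subst (λ st → Fits x st σ) (sym (++-identityʳ st)) fits
  grow x σ (suc n) st dis fits =
    let open Snoc x st σ dis fits
        (ext , len , dis″ , fits″) = grow x σ n (st ++ o ∷ []) distinct fits′
        assoc = ++-assoc st (o ∷ []) ext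
    in o ∷ ext ,
       trans (sym (cong length assoc)) (trans len
         (trans (cong (_+ n) (trans (length-++ st) (+-comm (length st) 1))) (sym (+-suc (length st) n)))) ,
       subst (Distinct x) assoc dis″ , subst (λ st → Fits x st σ) assoc fits″

  module Generic (x : W) (st : State) (dis : Distinct x st) where
    private
      S : ℕ
      S = length st

      entryAt : ∀ l → Dec (pair 0 l < S) → Maybe Index
      entryAt l (yes _) = just (index x (st ‼ pair 0 l))
      entryAt l (no _)  = nothing

      entries : List (Maybe Index)
      entries = applyUpTo (λ l → entryAt l (pair 0 l <? S)) S

      nth-entries : ∀ {l} → pair 0 l < S → nth nothing entries l ≡ just (index x (st ‼ pair 0 l))
      nth-entries {l} s< = trans
        (nth-applyUpTo (λ l → entryAt l (pair 0 l <? S)) (≤-<-trans (snd≤pair 0 l) s<)) (go _)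
        where
        go : ∀ d → entryAt l d ≡ just (index x (st ‼ pair 0 l))
        go (yes _) = refl
        go (no ≮)  = contradiction s< ≮

      nth-entries⁻ : ∀ {l ι} → nth nothing entries l ≡ just ι → pair 0 l < S × index x (st ‼ pair 0 l) ≡ ι
      nth-entries⁻ {l} {ι} e = go (pair 0 l <? S) (trans (sym (nth-applyUpTo (λ l → entryAt l (pair 0 l <? S))
        (subst (l <_) (length-applyUpTo _ S) (nth-nothing entries e)))) e)
        where
        go : ∀ d → entryAt l d ≡ just ι → pair 0 l < S × index x (st ‼ pair 0 l) ≡ ι
        go (yes s<) e = s< , just-injective e

      entries-distinct : ∀ l l′ ι κ → nth nothing entries l ≡ just ι → nth nothing entries l′ ≡ just κ →
                         ι ≋ κ → l ≡ l′
      entries-distinct l l′ ι κ e e′ ι≋κ with nth-entries⁻ e | nth-entries⁻ e′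
      ... | s< , refl | s′< , refl = dis 0 l l′ s< s′< (≋⇒EqObject ι≋κ)

      bound : ∃[ N ] (∀ s m → s < S → m < S → pair s m < N)
      bound = bounded₂ pair S (λ _ → S)

      bits : String
      bits = applyUpTo (flat (image x (st ‼_))) (proj₁ bound)

    -- The listed reals enter as whole rows through `entries`; the finitely many determined bits of
    -- higher levels all have codes below the length of `bits`.
    generic : ∀ t → ∃[ σ ] D t σ × Fits x st σ
    generic t = let (σ , Dσ , len , rows , rest) = ρ-generic entries entries-distinct bits t in
                σ , Dσ , fits σ rows rest
      where
      fits : ∀ σ →
        (∀ l ι → nth nothing entries l ≡ just ι → ∀ m → code 0 l m < length σ → at σ (code 0 l m) ≡ ρ ι m) →
        (∀ i k m → code (suc i) k m < length bits → at σ (code (suc i) k m) ≡ at bits (code (suc i) k m)) →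
        Fits x st σ
      fits σ rows rest zero    k m c< s< = sym (rows k _ (nth-entries s<) m c<)
      fits σ rows rest (suc i) k m c< (s< , s′<) = sym (trans
        (rest i k m (subst (code (suc i) k m <_) (sym (length-applyUpTo _ (proj₁ bound))) c<N))
        (trans (nth-applyUpTo (flat (image x (st ‼_))) c<N) (flat-code (image x (st ‼_)) (suc i) k m)))
        where
        c<N : code (suc i) k m < proj₁ bound
        c<N = proj₂ bound (pair (suc i) k) m s′< (≤-<-trans (snd≤pair i m) s<)

  module Enlargement (x : W) (t : ℕ) (st : State) (dis : Distinct x st)
                    (σ : String) (Dσ : D t σ) (fits : Fits x st σ) where
    i : ℕ
    i = proj₁ (proj₁ tasks t)
    o : Object
    o = proj₂ (proj₁ tasks t)

    memberSlot : ℕ → ℕ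
    memberSlot c = let (i , _ , m) = uncode c in pair (pred i) m

    B : ∃[ N ] (∀ c → c < length σ → memberSlot c < N)
    B = bounded memberSlot (length σ)

    -- So large that slot `goal`, of the level of the task, lies past `st`, past `t` and past every
    -- slot that `σ` refers to; an object put there cannot disturb `σ`.
    column : ℕ
    column = suc t + length st + length σ + proj₁ B

    goal : ℕ
    goal = pair i column

    column≤goal : column ≤ goal
    column≤goal = snd≤pair i column
    B≤goal : proj₁ B ≤ goal
    B≤goal = ≤-trans (m≤n+m _ _) column≤goal
    σ≤goal : length σ ≤ goal
    σ≤goal = ≤-trans (≤-trans (m≤n+m _ _) (m≤m+n _ (proj₁ B))) column≤goal
    st≤goal : length st ≤ goal
    st≤goal = ≤-trans (≤-trans (m≤n+m _ (suc t)) (≤-trans (m≤m+n _ (length σ)) (m≤m+n _ (proj₁ B)))) column≤goal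
    t<goal : t < goal
    t<goal = ≤-trans (≤-trans (m≤m+n (suc t) (length st)) (≤-trans (m≤m+n _ (length σ)) (m≤m+n _ (proj₁ B)))) column≤goal

    grown : ∃[ ext ] length (st ++ ext) ≡ length st + (goal ∸ length st) × Distinct x (st ++ ext) × Fits x (st ++ ext) σ
    grown = grow x σ (goal ∸ length st) st dis fits

    ext : State
    ext = proj₁ grown
    len : length (st ++ ext) ≡ goal
    len = trans (proj₁ (proj₂ grown)) (m+[n∸m]≡n st≤goal)
    dis′ : Distinct x (st ++ ext)
    dis′ = proj₁ (proj₂ (proj₂ grown))

    decided : ∀ i k m → code i k m < length σ → Decided goal i k m
    decided zero    k m c< = <-≤-trans (≤-<-trans (slot≤code 0 k m) c<) σ≤goal
    decided (suc i) k m c< =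
      <-≤-trans (subst (_< proj₁ B) (cong (λ (i , _ , m) → pair (pred i) m) (uncode-code (suc i) k m))
                       (proj₂ B (code (suc i) k m) c<)) B≤goal ,
      <-≤-trans (≤-<-trans (slot≤code (suc i) k m) c<) σ≤goal

    agrees′ : Agrees x (st ++ ext) σ
    agrees′ i k m c< = d , proj₂ (proj₂ (proj₂ grown)) i k m c< d
      where
      d : Decided (length (st ++ ext)) i k m
      d = subst (λ S → Decided S i k m) (sym len) (decided i k m c<)

    finish : Dec (Listed x (st ++ ext) (i , o)) → ∃[ ext ] Step x t st ext
    finish (yes listed) = ext , dis′ , (σ , Dσ , agrees′) , listed , subst (t <_) (sym len) t<goal
    finish (no unlisted) = ext ++ o ∷ [] , subst Good (++-assoc st ext (o ∷ [])) good
      where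
      Good : State → Set
      Good st = Distinct x st × (∃[ σ ] D t σ × Agrees x st σ) × Listed x st (i , o) × t < length st
      len′ : length ((st ++ ext) ++ o ∷ []) ≡ suc goal
      len′ = trans (length-++ (st ++ ext)) (trans (+-comm _ 1) (cong suc len))
      good : Good ((st ++ ext) ++ o ∷ [])
      good = Distinct-snoc {x} {st ++ ext} o dis′ (λ j k k′ s≡ s′< eq → fresh (pair-injective (trans s≡ len)) s′< eq) ,
             (σ , Dσ , Agrees-++ {x} {st ++ ext} {σ} (o ∷ []) agrees′) ,
             (column , subst (goal <_) (sym len′) (n<1+n goal) ,
               subst (λ o′ → EqObject x i o′ o)
                 (sym (trans (cong (((st ++ ext) ++ o ∷ []) ‼_) (sym len)) (nth-length (st ++ ext)))) EqObject-refl) ,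
             subst (t <_) (sym len′) (m<n⇒m<1+n t<goal)
        where
        fresh : ∀ {j k k′} → (j , k) ≡ (i , column) → pair j k′ < length (st ++ ext) →
                ¬ EqObject x j ((st ++ ext) ‼ pair j k′) o
        fresh {k′ = k′} refl s′< eq = unlisted (k′ , s′< , eq)

  abstract
    step : ∀ x t st → Distinct x st → ∃[ ext ] Step x t st ext
    step x t st dis = let (σ , Dσ , fits) = Generic.generic x st dis t in
      Enlargement.finish x t st dis σ Dσ fits em

  Chosen : W → ℕ → State → ℕ → Set
  Chosen x t st = Least (λ n → Step x t st (proj₁ blocks n))

  abstract
    chosen : ∀ x t st → Distinct x st → ∃[ n ] Chosen x t st n
    chosen x t st dis =
      let (ext , s) = step x t st dis ; (n , e) = proj₂ blocks ext in
      least (λ n → Step x t st (proj₁ blocks n)) (n , subst (Step x t st) (sym e) s)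

  advance : ∀ x t → Σ State (Distinct x) → Σ State (Distinct x)
  advance x t (st , dis) =
    let (n , s , _) = chosen x t st dis in st ++ proj₁ blocks n , proj₁ s

  states : (x : W) → ℕ → Σ State (Distinct x)
  states x zero    = [] , λ _ _ _ ()
  states x (suc t) = advance x t (states x t)

  state : W → ℕ → State
  state x t = proj₁ (states x t)

  state-step : ∀ x t → ∃[ n ] Chosen x t (state x t) n × state x (suc t) ≡ state x t ++ proj₁ blocks n
  state-step x t = let (n , c) = chosen x t (state x t) (proj₂ (states x t)) in n , c , refl

  private
    state-good : ∀ x t → (∃[ σ ] D t σ × Agrees x (state x (suc t)) σ) ×
                         Listed x (state x (suc t)) (proj₁ tasks t) × t < length (state x (suc t))
    state-good x t = proj₂ (proj₁ (proj₂ (chosen x t (state x t) (proj₂ (states x t)))))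

  -- The last clause of `Step` ensures that slot `s` is filled after `suc s` steps.
  enum : W → ℕ → Object
  enum x s = state x (suc s) ‼ s

  private
    state-mono : ∀ x {t t′} → t ≤ t′ → ∀ s → s < length (state x t) → state x t ‼ s ≡ state x t′ ‼ s
    state-mono x {t} t≤t′ s s< = proj₂ (go (≤⇒≤′ t≤t′))
      where
      go : ∀ {t′} → t ≤′ t′ → s < length (state x t′) × state x t ‼ s ≡ state x t′ ‼ s
      go ≤′-refl = s< , refl
      go (≤′-step {t′} p) = let (s<′ , e) = go p in
        <-≤-trans s<′ (length-≤ (state x t′) _) , trans e (‼-++ (state x t′) _ s s<′)

    enum-state : ∀ x t s → s < length (state x t) → state x t ‼ s ≡ enum x s
    enum-state x t s s< with ≤-total t (suc s)
    ... | inj₁ t≤ = state-mono x t≤ s s<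
    ... | inj₂ ≤t = sym (state-mono x ≤t s (proj₂ (proj₂ (state-good x s))))

  reduct : W → W
  reduct x = image x (enum x)

  reduct-generic : ∀ x t → ∃[ σ ] D t σ × (∀ i k m → code i k m < length σ → reduct x i k m ≡ at σ (code i k m))
  reduct-generic x t =
    let (σ , Dσ , agr) = proj₁ (state-good x t) in
    σ , Dσ , λ i k m c< → let (d , e) = agr i k m c< in
      trans (sym (image-cong x (enum-state x (suc t)) i k m d)) e

  enum-onto : ∀ x i o → ∃[ k ] EqObject x i (enum x (pair i k)) o
  enum-onto x i o =
    let (t , e) = proj₂ tasks (i , o)
        (k , s< , eq) = subst (Listed x (state x (suc t))) e (proj₁ (proj₂ (state-good x t)))
    in k , subst (λ o′ → EqObject x i o′ o) (enum-state x (suc t) _ s<) eq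

-- The reduct preserves and reflects equality of the coded sets

Meets : W → String → Set
Meets w σ = ∀ i k m → code i k m < length σ → w i k m ≡ at σ (code i k m)

Forces : (ℕ → W → Set) → ℕ → String → Set
Forces U t σ = ∀ w → Meets w σ → U t w

RowsDistinct : (ℕ → W → Set) → Set
RowsDistinct U = ∀ i l l′ → ∃[ t ] (∀ w → U t w → l ≢ l′ → ∃[ m ] w i l m ≢ w i l′ m)

Covers : (ℕ → W → Set) → Set
Covers U = ∀ i m → ∃[ t ] (∀ w → U t w → ∃[ k ] w (suc i) k m ≡ true)

module Reduction (em : ExcludedMiddle 0ℓ) (U : ℕ → W → Set) (dense : DenseFamily (Forces U))
                 (rowsDistinct : RowsDistinct U) (covers : Covers U) where
  open Classical em
  open Objects em
  open Fusion em (Forces U) dense prefix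
  open Construction em (Forces U) dense

  reduct-meets : ∀ x t → U t (reduct x)
  reduct-meets x t = let (σ , Dσ , e) = reduct-generic x t in Dσ (reduct x) e

  -- Generic points have pairwise distinct rows, so only `l₁ ≡ l₂` is at stake.
  reduct-coherent : ∀ x → Coherent (reduct x)
  reduct-coherent x i k l₁ l₂ e = go (l₁ ≟ l₂)
    where
    go : Dec (l₁ ≡ l₂) → reduct x (suc i) k l₁ ≡ reduct x (suc i) k l₂
    go (yes refl) = refl
    go (no l₁≢l₂) = let (t , d) = rowsDistinct i l₁ l₂ ; (m , ≢) = d _ (reduct-meets x t) l₁≢l₂ in
                    contradiction (e m) ≢

  reduct-covering : ∀ x → Covering (reduct x)
  reduct-covering x i m = let (t , d) = covers i m in d _ (reduct-meets x t)

  -- For distinct indices, the point with their reals as rows 0 and 1 of level 0 meets a string that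
  -- forces these rows apart.
  ρ-injective : ∀ {ι κ} → ρ ι ≗ ρ κ → ι ≋ κ
  ρ-injective {ι} {κ} e = dne λ ι≉κ →
    let (t , d) = rowsDistinct 0 0 1
        (σ , Dσ , _ , rows , _) = ρ-generic (just ι ∷ just κ ∷ []) (distinct ι≉κ) [] t
        (m , ≢) = d (w σ) (Dσ (w σ) (w-meets σ rows)) (λ ())
    in ≢ (e m)
    where
    distinct : ¬ (ι ≋ κ) → ∀ l l′ ι′ κ′ → nth nothing (just ι ∷ just κ ∷ []) l ≡ just ι′ →
               nth nothing (just ι ∷ just κ ∷ []) l′ ≡ just κ′ → ι′ ≋ κ′ → l ≡ l′
    distinct ι≉κ 0 0 _ _ refl refl _ = refl
    distinct ι≉κ 0 1 _ _ refl refl s = contradiction s ι≉κ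
    distinct ι≉κ 1 0 _ _ refl refl s = contradiction (λ n → sym (s n)) ι≉κ
    distinct ι≉κ 1 1 _ _ refl refl _ = refl
    w : String → W
    w σ 0 0 m = ρ ι m
    w σ 0 1 m = ρ κ m
    w σ i k m = at σ (code i k m)
    w-meets : ∀ σ → (∀ l ι′ → nth nothing (just ι ∷ just κ ∷ []) l ≡ just ι′ →
      ∀ m → code 0 l m < length σ → at σ (code 0 l m) ≡ ρ ι′ m) → Meets (w σ) σ
    w-meets σ rows 0 0             m c< = sym (rows 0 ι refl m c<)
    w-meets σ rows 0 1             m c< = sym (rows 1 κ refl m c<)
    w-meets σ rows 0 (suc (suc k)) m c< = refl
    w-meets σ rows (suc i) k       m c< = refl

  reals-agree : ∀ {x x′ o o′} → index x o ≋ index x′ o′ → x 0 (top o) ≗ x′ 0 (top o′)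
  reals-agree eq = trunc-injective (λ s → proj₁ (∷-injective (cong proj₂ (eq s))))

  Match-sym : ∀ {x x′ i o o′} → Match x x′ i o o′ → Match x′ x i o′ o
  Match-sym (match e p) = match (sym e) (Pw.symmetric (λ { {j , _} (refl , s) → refl , Sim-sym j s }) p)

  partner : ∀ {x x′} → (∀ j → SameSets x x′ j) → ∀ i o → ∃[ o′ ] Match x x′ i o o′
  partner {x} {x′} same i o =
    let (k , s) = proj₁ (same i) (top o) ; (ps , p) = go (places o) in
    object k ps (label o) , match refl ((refl , s) ∷ p)
    where
    go : ∀ ps → ∃[ qs ] Pointwise (SimPlace x x′) (map (clip i) ps) (map (clip i) qs)
    go []             = [] , []
    go ((j , k) ∷ ps) = let (k′ , s) = proj₁ (same (j ⊓ i)) k ; (qs , p) = go ps in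
                        (j , k′) ∷ qs , (refl , s) ∷ p

  -- A match of the member exists by `partner` and is listed, in whatever order, by `enum-onto`;
  -- invariance of `Mem` makes it a member too.
  image-members : ∀ {x x′} → Coherent x → Coherent x′ → (∀ j → SameSets x x′ j) → ∀ i {l l′} →
    Match x x′ (suc i) (enum x (pair (suc i) l)) (enum x′ (pair (suc i) l′)) →
    ∀ k → reduct x (suc i) l k ≡ true →
    ∃[ k′ ] reduct x′ (suc i) l′ k′ ≡ true × Match x x′ i (enum x (pair i k)) (enum x′ (pair i k′))
  image-members {x} {x′} coh coh′ same i M k e =
    let (o′ , m) = partner same i (enum x (pair i k)) ; (k′ , eq) = enum-onto x′ i o′
        m′ = Match-ext m eq
    in k′ , trans (sym (Mem-cong coh coh′ m′ M)) e , m′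

  image-Sim : ∀ {x x′} → Coherent x → Coherent x′ → (∀ j → SameSets x x′ j) → ∀ i {l l′} →
    Match x x′ i (enum x (pair i l)) (enum x′ (pair i l′)) → Sim (reduct x) (reduct x′) i l l′
  image-Sim coh coh′ same zero    m = ρ-cong (Match⇒≋ m)
  image-Sim {x} {x′} coh coh′ same (suc i) {l} {l′} M =
    (λ k e → let (k′ , e′ , m) = image-members coh coh′ same i M k e in
             k′ , e′ , image-Sim coh coh′ same i m) ,
    (λ k e → let (k′ , e′ , m) = image-members coh′ coh (λ j → SameSets-sym (same j)) i (Match-sym M) k e in
             k′ , e′ , image-Sim coh coh′ same i (Match-sym m))

  reduct-preserves : ∀ {x x′} → Coherent x → Coherent x′ → (∀ j → SameSets x x′ j) →
                     ∀ i → SameSets (reduct x) (reduct x′) i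
  reduct-preserves {x} {x′} coh coh′ same i =
    forth coh coh′ same ,
    λ l → let (l′ , s) = forth coh′ coh (λ j → SameSets-sym (same j)) l in l′ , Sim-sym i s
    where
    forth : ∀ {x x′} → Coherent x → Coherent x′ → (∀ j → SameSets x x′ j) →
            ∀ l → ∃[ l′ ] Sim (reduct x) (reduct x′) i l l′
    forth {x} {x′} coh coh′ same l =
      let (o′ , m) = partner same i (enum x (pair i l)) ; (l′ , eq) = enum-onto x′ i o′ in
      l′ , image-Sim coh coh′ same i (Match-ext m eq)

  -- Objects of x and x′ with equal images have equal labels, as the elements with
  -- query rules show, and then equal top sets, as those with default rule show.

  Corresponds : W → W → ℕ → Object → Object → Set
  Corresponds x x′ i o o′ = label o ≡ label o′ × Sim x x′ i (top o) (top o′)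

  Recovers : W → W → ℕ → Set
  Recovers x x′ i = ∀ l l′ → Sim (reduct x) (reduct x′) i l l′ →
                    Corresponds x x′ i (enum x (pair i l)) (enum x′ (pair i l′))

  Recovers-sym : ∀ {x x′ i} → Recovers x x′ i → Recovers x′ x i
  Recovers-sym {i = i} r l l′ s = let (e , t) = r l′ l (Sim-sym i s) in sym e , Sim-sym i t

  EqObject-top : ∀ {x i o o′} → EqObject x i o o′ → x i (top o) ≗ x i (top o′)
  EqObject-top (eqObject _ (eqPlace _ e ∷ _)) = e

  -- Only the label and the top set of `o` are known to survive the passage to `x′`; the objects fed
  -- in below therefore carry rules that read nothing but labels or tops.
  transfer : ∀ {x x′} → Coherent x → ∀ i → Recovers x x′ i → SameSets (reduct x) (reduct x′) i →
    ∀ {l l′} → Sim (reduct x) (reduct x′) (suc i) l l′ → ∀ o →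
    ∃[ o′ ] Corresponds x x′ i o o′ ×
            Mem x i o (enum x (pair (suc i) l)) ≡ Mem x′ i o′ (enum x′ (pair (suc i) l′))
  transfer {x} {x′} coh i rec same {l} {l′} S o =
    let (k , eq) = enum-onto x i o ; (k′ , s) = proj₁ same k ; (e , t) = rec k k′ s in
    enum x′ (pair i k′) ,
    (trans (sym (eq-label eq)) e , Sim-extˡ i (λ m → sym (EqObject-top eq m)) t) ,
    trans (sym (Mem-cong coh coh (EqObject⇒Match eq) (EqObject⇒Match EqObject-refl)))
          (Sim-bit (reduct-coherent x) (reduct-coherent x′) i s S)

  -- A rank above both containers lets the rule of the member decide on both sides.
  highLabel : ∀ r O O′ → ∃[ L ] rule L ≡ r × rank (label O) < rank L × rank (label O′) < rank L
  highLabel r O O′ =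
    let (L , e , e′ , _) = labelled (suc (rank (label O) ⊔ rank (label O′))) r [] in
    L , e′ , subst (rank (label O) <_) (sym e) (s≤s (m≤m⊔n _ _)) ,
    subst (rank (label O′) <_) (sym e) (s≤s (m≤n⊔m (rank (label O)) _))

  Mem-query : ∀ x i o O L → rule (label o) ≡ query L → rank (label O) < rank (label o) →
              Mem x i o O ≡ does (label O ≟ L)
  Mem-query x i o O L e r< =
    trans (Mem-member x i r<) (cong (λ r → eval r (suc i , label O , diagram x (params i o) (params (suc i) O)) (x (suc i) (top O) (top o))) e)

  Mem-default : ∀ x i o O → rule (label o) ≡ default → rank (label O) < rank (label o) →
                Mem x i o O ≡ x (suc i) (top O) (top o)
  Mem-default x i o O e r< =
    trans (Mem-member x i r<) (cong (λ r → eval r (suc i , label O , diagram x (params i o) (params (suc i) O)) (x (suc i) (top O) (top o))) e)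

  does-≟ : ∀ m n → does (m ≟ n) ≡ true → m ≡ n
  does-≟ m n e = ≡ᵇ⇒≡ m n (subst T (sym e) _)

  -- An object with top `m` and a `default` rule of high rank belongs to `O` exactly if the set of
  -- `m` belongs to the top set of `O`; its counterpart behaves likewise towards `O′`.
  recovers-members : ∀ {x x′} → Coherent x → ∀ i → Recovers x x′ i → SameSets (reduct x) (reduct x′) i →
    ∀ {l l′} → Sim (reduct x) (reduct x′) (suc i) l l′ →
    ∀ m → x (suc i) (top (enum x (pair (suc i) l))) m ≡ true →
    ∃[ m′ ] x′ (suc i) (top (enum x′ (pair (suc i) l′))) m′ ≡ true × Sim x x′ i m m′
  recovers-members {x} {x′} coh i rec same {l} {l′} S m e =
    let O = enum x (pair (suc i) l) ; O′ = enum x′ (pair (suc i) l′)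
        (L , rule≡ , r< , r′<) = highLabel default O O′
        (o′ , (label≡ , s) , bits) = transfer coh i rec same S (object m [] L)
    in top o′ ,
       trans (sym (Mem-default x′ i o′ O′ (trans (cong rule (sym label≡)) rule≡)
                    (subst (λ L → rank (label O′) < rank L) label≡ r′<)))
         (trans (sym bits) (trans (Mem-default x i (object m [] L) O rule≡ r<) e)) ,
       s

  recovers : ∀ {x x′} → Coherent x → Coherent x′ → ∀ i → SameSets (reduct x) (reduct x′) i → Recovers x x′ i
  recovers {x} {x′} coh coh′ zero    same l l′ s =
    cong proj₁ (same-index 0) , reals-agree {x} {x′} {enum x (pair 0 l)} {enum x′ (pair 0 l′)} same-index
    where
    same-index : index x (enum x (pair 0 l)) ≋ index x′ (enum x′ (pair 0 l′))
    same-index = ρ-injective s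
  recovers {x} {x′} coh coh′ (suc i) same l l′ S =
    -- The object asking for `label O` belongs to `O`, so its counterpart belongs to `O′`, which
    -- must then have that label.
    sym (does-≟ (label O′) (label O) (trans (sym query′)
      (trans (sym bits) (trans (Mem-query x i (object 0 [] L) O (label O) rule≡ r<)
                               (dec-true (label O ≟ label O) refl))))) ,
    recovers-members coh i rec sameᵢ S ,
    (λ m e → let (m′ , e′ , s) = recovers-members coh′ i (Recovers-sym {x} {x′} {i} rec)
                                   (SameSets-sym {reduct x} {reduct x′} {i} sameᵢ) (Sim-sym (suc i) S) m e
             in m′ , e′ , Sim-sym i s)
    where
    O = enum x (pair (suc i) l)
    O′ = enum x′ (pair (suc i) l′)
    sameᵢ : SameSets (reduct x) (reduct x′) i
    sameᵢ = SameSets-pred (reduct-covering x) (reduct-covering x′) same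
    rec : Recovers x x′ i
    rec = recovers coh coh′ i sameᵢ
    high : ∃[ L ] rule L ≡ query (label O) × rank (label O) < rank L × rank (label O′) < rank L
    high = highLabel (query (label O)) O O′
    L : ℕ
    L = proj₁ high
    rule≡ : rule L ≡ query (label O)
    rule≡ = proj₁ (proj₂ high)
    r< : rank (label O) < rank L
    r< = proj₁ (proj₂ (proj₂ high))
    moved : ∃[ o′ ] Corresponds x x′ i (object 0 [] L) o′ × Mem x i (object 0 [] L) O ≡ Mem x′ i o′ O′
    moved = transfer coh i rec sameᵢ S (object 0 [] L)
    label≡ : L ≡ label (proj₁ moved)
    label≡ = proj₁ (proj₁ (proj₂ moved))
    bits : Mem x i (object 0 [] L) O ≡ Mem x′ i (proj₁ moved) O′
    bits = proj₂ (proj₂ moved)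
    query′ : Mem x′ i (proj₁ moved) O′ ≡ does (label O′ ≟ label O)
    query′ = Mem-query x′ i (proj₁ moved) O′ (label O) (trans (cong rule (sym label≡)) rule≡)
      (subst (λ L → rank (label O′) < rank L) label≡ (proj₂ (proj₂ (proj₂ high))))

  -- Each set of level `i` is the top set of a listed object, and `recovers` carries tops across.
  reduct-reflects : ∀ {x x′} → Coherent x → Coherent x′ → ∀ i →
                    SameSets (reduct x) (reduct x′) i → SameSets x x′ i
  reduct-reflects coh coh′ i same =
    forth coh coh′ same ,
    λ l → let (l′ , s) = forth coh′ coh (SameSets-sym same) l in l′ , Sim-sym i s
    where
    forth : ∀ {x x′} → Coherent x → Coherent x′ → SameSets (reduct x) (reduct x′) i → ∀ m → ∃[ m′ ] Sim x x′ i m m′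
    forth {x} {x′} coh coh′ same m =
      let (k , eq) = enum-onto x i (object m [] 0)
          (k′ , s) = proj₁ same k
          (_ , t)  = recovers coh coh′ i same k k′ s
      in top (enum x′ (pair i k′)) , Sim-extˡ i (λ n → sym (EqObject-top eq n)) t

-- Borel sets and maps with countably many values

module BorelSets (em : ExcludedMiddle 0ℓ) (S : Space) where
  open Classical em

  private variable
    P Q : Pred (Carrier S) 0ℓ

  -- Excluded middle decides `A`; this disposes of all side conditions that do not mention the
  -- point.
  borel-const : (A : Set) → Borel S (λ _ → A)
  borel-const A = go em
    where
    empty : Borel S (λ _ → ⊥)
    empty = open-set (λ _ ())
    go : Dec A → Borel S (λ _ → A)
    go (yes a) = resp-≐ ((λ _ → a) , (λ _ ())) (complement empty)
    go (no ¬a) = resp-≐ ((λ ()) , ¬a) empty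

  borel-∃ : Countable I → {P : I → Pred (Carrier S) 0ℓ} → (∀ i → Borel S (P i)) → Borel S (λ x → ∃[ i ] P i x)
  borel-∃ (e , onto) {P} b = resp-≐
    ((λ (n , p) → e n , p) , λ {x} (i , p) → let (n , q) = onto i in n , subst (λ i → P i x) (sym q) p)
    (union (λ n → b (e n)))

  borel-∀ : Countable I → {P : I → Pred (Carrier S) 0ℓ} → (∀ i → Borel S (P i)) → Borel S (λ x → ∀ i → P i x)
  borel-∀ c b = resp-≐ ((λ ¬∃ i → dne λ ¬p → ¬∃ (i , ¬p)) , (λ p (i , ¬p) → ¬p (p i)))
    (complement (borel-∃ c (λ i → complement (b i))))

  borel-× : Borel S P → Borel S Q → Borel S (λ x → P x × Q x)
  borel-× {P} {Q} p q = resp-≐ ((λ f → f true , f false) , (λ { (a , b) true → a ; (a , b) false → b }))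
    (borel-∀ countable-Bool {λ b → if b then P else Q} (λ { true → p ; false → q }))

  borel-→ : Borel S P → Borel S Q → Borel S (λ x → P x → Q x)
  borel-→ p q = resp-≐ ((λ ¬pq a → dne λ ¬b → ¬pq (a , ¬b)) , (λ f (a , ¬b) → ¬b (f a)))
    (complement (borel-× p (complement q)))

  -- Meant for countable targets, where preimages of single values generate all others.
  Measurable : (Carrier S → I) → Set₁
  Measurable h = ∀ v → Borel S (λ x → h x ≡ v)

  measurable-const : (v : I) → Measurable (λ _ → v)
  measurable-const v w = borel-const (v ≡ w)

  measurable-bind : Countable I → {h : Carrier S → I} {g : I → Carrier S → K} →
    Measurable h → (∀ i → Measurable (g i)) → Measurable (λ x → g (h x) x)
  measurable-bind c {h} {g} mh mg v = resp-≐
    ((λ { (i , refl , e) → e }) , λ {x} e → h x , refl , e)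
    (borel-∃ c (λ i → borel-× (mh i) (mg i v)))

  measurable-∘ : Countable I → (g : I → K) {h : Carrier S → I} → Measurable h → Measurable (g ∘ h)
  measurable-∘ c g mh = measurable-bind c mh (λ i → measurable-const (g i))

  measurable-, : {h : Carrier S → I} {g : Carrier S → K} →
    Measurable h → Measurable g → Measurable (λ x → h x , g x)
  measurable-, mh mg (u , v) = resp-≐
    ((λ (p , q) → cong₂ _,_ p q) , (λ e → cong proj₁ e , cong proj₂ e)) (borel-× (mh u) (mg v))

  borel-≡ : Countable I → {h g : Carrier S → I} → Measurable h → Measurable g → Borel S (λ x → h x ≡ g x)
  borel-≡ c {h} {g} mh mg = resp-≐ ((λ (_ , p , q) → trans p (sym q)) , λ {x} e → g x , e , refl)
    (borel-∃ c (λ v → borel-× (mh v) (mg v)))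

  measurable-truth : Borel S P → Measurable (λ x → truth (P x))
  measurable-truth p true  = resp-≐ (truth-yes , truth⇒) p
  measurable-truth {P} p false = resp-≐ (falsity , λ e a → contradiction (trans (sym (truth-yes a)) e) (λ ()))
    (complement p)
    where
    falsity : ∀ {x} → ¬ P x → truth (P x) ≡ false
    falsity = dec-false em

  measurable-map : {g : I → Carrier S → K} → (∀ i → Measurable (g i)) → ∀ is → Measurable (λ x → map (λ i → g i x) is)
  measurable-map mg []       v        = borel-const ([] ≡ v)
  measurable-map mg (i ∷ is) []       = resp-≐ ((λ ()) , (λ ())) (borel-const ⊥)
  measurable-map mg (i ∷ is) (v ∷ vs) = resp-≐ ((λ (p , q) → cong₂ _∷_ p q) , ∷-injective)
    (borel-× (mg i v) (measurable-map mg is vs))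

  measurable-applyUpTo : {g : ℕ → Carrier S → K} → (∀ n → Measurable (g n)) →
    ∀ n → Measurable (λ x → applyUpTo (λ m → g m x) n)
  measurable-applyUpTo mg zero    v        = borel-const ([] ≡ v)
  measurable-applyUpTo mg (suc n) []       = resp-≐ ((λ ()) , (λ ())) (borel-const ⊥)
  measurable-applyUpTo mg (suc n) (v ∷ vs) = resp-≐ ((λ (p , q) → cong₂ _∷_ p q) , ∷-injective)
    (borel-× (mg 0 v) (measurable-applyUpTo (mg ∘ suc) n vs))

  measurable-if : ∀ b {h g : Carrier S → I} → Measurable h → Measurable g → Measurable (λ x → if b then h x else g x)
  measurable-if true  mh mg = mh
  measurable-if false mh mg = mg

  borel-Pointwise : {R : Carrier S → I → K → Set} → (∀ i k → Borel S (λ x → R x i k)) →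
    ∀ is ks → Borel S (λ x → Pointwise (R x) is ks)
  borel-Pointwise b []       []       = resp-≐ ((λ _ → []) , (λ _ → refl)) (borel-const (0 ≡ 0))
  borel-Pointwise b []       (_ ∷ _)  = resp-≐ ((λ ()) , (λ ())) (borel-const ⊥)
  borel-Pointwise b (_ ∷ _)  []       = resp-≐ ((λ ()) , (λ ())) (borel-const ⊥)
  borel-Pointwise b (i ∷ is) (k ∷ ks) = resp-≐ ((λ (p , q) → p ∷ q) , (λ { (p ∷ q) → p , q }))
    (borel-× (b i k) (borel-Pointwise b is ks))

-- The reduct is a Borel function of the point

module BorelReduct (em : ExcludedMiddle 0ℓ) (D : ℕ → String → Set) (dense : DenseFamily D)
                   (S : Space) (p : Carrier S → W) where
  open Classical em
  open Objects em
  open Fusion em D dense prefix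
  open Construction em D dense
  open BorelSets em S

  module _ (bits : ∀ i k m → Measurable (λ x → p x i k m)) where

    borel-EqPlace : ∀ μ ν → Borel S (λ x → EqPlace (p x) μ ν)
    borel-EqPlace μ ν = resp-≐ ((λ (l , r) → eqPlace l r) , (λ (eqPlace l r) → l , r))
      (borel-× (borel-const (proj₁ μ ≡ proj₁ ν))
        (borel-∀ countable-ℕ (λ m → borel-≡ countable-Bool (bits _ (proj₂ μ) m) (bits _ (proj₂ ν) m))))

    measurable-entry : ∀ μ ν → Measurable (λ x → entry (p x) μ ν)
    measurable-entry μ ν = measurable-, (measurable-truth (borel-EqPlace μ ν))
      (measurable-truth (borel-× (borel-const (suc (proj₁ μ) ≡ proj₁ ν)) (bits (proj₁ ν) (proj₂ ν) (proj₂ μ) true)))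

    measurable-diagram : ∀ ps qs → Measurable (λ x → diagram (p x) ps qs)
    measurable-diagram ps qs = measurable-map (λ μ → measurable-map (λ ν → measurable-entry μ ν) qs) ps

    measurable-Mem : ∀ i o O → Measurable (λ x → Mem (p x) i o O)
    measurable-Mem i o O = measurable-if (does (rank (label O) <? rank (label o)))
      (decision (rule (label o)) (suc i) (label O)) (decision (rule (label O)) i (label o))
      where
      countable-Diagram : Countable (Diagram × Bool)
      countable-Diagram = countable-×
        (countable-List (countable-List (countable-× countable-Bool countable-Bool))) countable-Bool
      decision : ∀ r j L → Measurable (λ x → eval r (j , L , diagram (p x) (params i o) (params (suc i) O))
                                                    (p x (suc i) (top O) (top o)))
      decision r j L = measurable-∘ countable-Diagram (λ (δ , d) → eval r (j , L , δ) d)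
        (measurable-, (measurable-diagram _ _) (bits _ _ _))

    measurable-ρ : ∀ o m → Measurable (λ x → ρ (index (p x) o) m)
    measurable-ρ o m = measurable-∘ (countable-List (countable-List countable-Bool)) (λ σs → ρ-at m (label o , σs))
      λ v → resp-≐ ((λ e → trans (sym (map-∘ (params 0 o))) e) , (λ e → trans (map-∘ (params 0 o)) e))
        (measurable-map (λ ν → measurable-applyUpTo (bits (proj₁ ν) (proj₂ ν)) (suc m)) (params 0 o) v)

    measurable-image : ∀ e i k m → Measurable (λ x → image (p x) e i k m)
    measurable-image e zero    k m = measurable-ρ (e (pair 0 k)) m
    measurable-image e (suc i) k m = measurable-Mem i (e (pair i m)) (e (pair (suc i) k))

    borel-EqObject : ∀ i o o′ → Borel S (λ x → EqObject (p x) i o o′)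
    borel-EqObject i o o′ = resp-≐ ((λ (e , q) → eqObject e q) , (λ (eqObject e q) → e , q))
      (borel-× (borel-const _) (borel-Pointwise borel-EqPlace (params i o) (params i o′)))

    borel-Distinct : ∀ st → Borel S (λ x → Distinct (p x) st)
    borel-Distinct st = borel-∀ countable-ℕ λ i → borel-∀ countable-ℕ λ k → borel-∀ countable-ℕ λ k′ →
      borel-→ (borel-const _) (borel-→ (borel-const _) (borel-→ (borel-EqObject i _ _) (borel-const _)))

    borel-Agrees : ∀ st σ → Borel S (λ x → Agrees (p x) st σ)
    borel-Agrees st σ = borel-∀ countable-ℕ λ i → borel-∀ countable-ℕ λ k → borel-∀ countable-ℕ λ m →
      borel-→ (borel-const _) (borel-× (borel-const _) (measurable-image (st ‼_) i k m _))

    borel-Step : ∀ t st ext → Borel S (λ x → Step (p x) t st ext)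
    borel-Step t st ext = borel-× (borel-Distinct (st ++ ext)) (borel-×
      (borel-∃ (countable-List countable-Bool) λ σ → borel-× (borel-const _) (borel-Agrees (st ++ ext) σ))
      (borel-× (borel-∃ countable-ℕ λ k → borel-× (borel-const _) (borel-EqObject _ _ _)) (borel-const _)))

    borel-Chosen : ∀ t st n → Borel S (λ x → Chosen (p x) t st n)
    borel-Chosen t st n = borel-× (borel-Step t st _)
      (borel-∀ countable-ℕ λ m → borel-→ (borel-const _) (complement (borel-Step t st _)))

    -- Since least choices are unique, the recursion unfolds into a countable union over the
    -- previous state and the chosen index.
    measurable-state : ∀ t → Measurable (λ x → state (p x) t)
    measurable-state zero    v = borel-const _
    measurable-state (suc t) v = resp-≐ (forth , back)
      (borel-∃ (countable-List countable-Object) λ st → borel-× (measurable-state t st)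
        (borel-∃ countable-ℕ λ n → borel-× (borel-Chosen t st n) (borel-const _)))
      where
      Next : Carrier S → Set
      Next x = ∃[ st ] state (p x) t ≡ st × (∃[ n ] Chosen (p x) t st n × st ++ proj₁ blocks n ≡ v)
      forth : ∀ {x} → Next x → state (p x) (suc t) ≡ v
      forth {x} (_ , refl , n , c , e) = let (n′ , c′ , e′) = state-step (p x) t in
        trans e′ (trans (cong (λ n → state (p x) t ++ proj₁ blocks n) (least-unique c′ c)) e)
      back : ∀ {x} → state (p x) (suc t) ≡ v → Next x
      back {x} e = let (n , c , e′) = state-step (p x) t in _ , refl , n , c , trans (sym e′) e

    measurable-enum : ∀ s → Measurable (λ x → enum (p x) s)
    measurable-enum s = measurable-∘ (countable-List countable-Object) (_‼ s) (measurable-state (suc s))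

    measurable-reduct : ∀ i k m → Measurable (λ x → reduct (p x) i k m)
    measurable-reduct zero    k m = measurable-bind countable-Object (measurable-enum (pair 0 k)) (λ o → measurable-ρ o m)
    measurable-reduct (suc i) k m = measurable-bind countable-Object (measurable-enum (pair i m)) λ o →
      measurable-bind countable-Object (measurable-enum (pair (suc i) k)) λ O → measurable-Mem i o O

-- Points of X_n and points of X_ω

module _ {n : ℕ ⁺} where

  restrict : W → Seqs n
  restrict w i _ = w i

  Represents : Seqs n → W → Set
  Represents x w = ∀ i (p : i ≺ n) k m → x i p k m ≡ w i k m

  module _ {x x′ : Seqs n} {w w′ : W} (r : Represents x w) (r′ : Represents x′ w′) where

    ≈⇒Sim : ∀ j (p : j ≺ n) {l l′} → a x j p l ≈ a x′ j p l′ → Sim w w′ j l l′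
    ≈⇒Sim zero    p {l} {l′} e       = λ m → trans (sym (r 0 p l m)) (trans (e m) (r′ 0 p l′ m))
    ≈⇒Sim (suc j) p {l} {l′} (f , g) =
      (λ k e → let ((k′ , e′) , s) = f (k , trans (r (suc j) p l k) e) in
               k′ , trans (sym (r′ (suc j) p l′ k′)) e′ , ≈⇒Sim j (≺-pred p) s) ,
      (λ k′ e′ → let ((k , e) , s) = g (k′ , trans (r′ (suc j) p l′ k′) e′) in
                 k , trans (sym (r (suc j) p l k)) e , ≈⇒Sim j (≺-pred p) s)

    Sim⇒≈ : ∀ j (p : j ≺ n) {l l′} → Sim w w′ j l l′ → a x j p l ≈ a x′ j p l′
    Sim⇒≈ zero    p {l} {l′} e       = λ m → trans (r 0 p l m) (trans (e m) (sym (r′ 0 p l′ m)))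
    Sim⇒≈ (suc j) p {l} {l′} (f , g) =
      (λ (k , e) → let (k′ , e′ , s) = f k (trans (sym (r (suc j) p l k)) e) in
                   (k′ , trans (r′ (suc j) p l′ k′) e′) , Sim⇒≈ j (≺-pred p) s) ,
      (λ (k′ , e′) → let (k , e , s) = g k′ (trans (sym (r′ (suc j) p l′ k′)) e′) in
                     (k , trans (r (suc j) p l k) e) , Sim⇒≈ j (≺-pred p) s)

    A≈⇔SameSets : ∀ j (p : j ≺ n) → A x j p ≈ A x′ j p ⇔ SameSets w w′ j
    A≈⇔SameSets j p = mk⇔
      (λ (f , g) → (λ l → let (l′ , s) = f l in l′ , ≈⇒Sim j p s) , (λ l → let (l′ , s) = g l in l′ , ≈⇒Sim j p s))
      (λ (f , g) → (λ l → let (l′ , s) = f l in l′ , Sim⇒≈ j p s) , (λ l → let (l′ , s) = g l in l′ , Sim⇒≈ j p s))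

  restrict-InX : ∀ {w} → Coherent w → Covering w → (∀ i k → ∃[ m ] w (suc i) k m ≡ true) → InX (restrict w)
  restrict-InX coh cov ne = record
    { covering = λ i _ m → cov i m
    ; nonempty = λ i _ k → ne i k
    ; coherent = λ i _ k l₁ l₂ → coh i k l₁ l₂
    }

  module Padding (em : ExcludedMiddle 0ℓ) where

    patchRow : Seqs n → W → ∀ i → Dec (i ≺ n) → ℕ → 2^ℕ
    patchRow x w i (yes p) = x i p
    patchRow x w i (no _)  = w i

    patch : Seqs n → W → W
    patch x w i = patchRow x w i em

    patch-represents : ∀ x w → Represents x (patch x w)
    patch-represents x w i p k m = go em
      where
      go : ∀ d → x i p k m ≡ patchRow x w i d k m
      go (yes _) = refl
      go (no ¬p) = contradiction p ¬p

    -- All rows beyond n are constantly true, so that every further a_j is the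
    -- set of all sets below.

    pad : Seqs n → W
    pad x = patch x (λ _ _ _ → true)

    pad-beyond : ∀ x i k m → ¬ (i ≺ n) → pad x i k m ≡ true
    pad-beyond x i k m ¬p = go em
      where
      go : ∀ d → patchRow x (λ _ _ _ → true) i d k m ≡ true
      go (yes p) = contradiction p ¬p
      go (no _)  = refl

    pad-covering : ∀ {x} → InX x → Covering (pad x)
    pad-covering {x} q i m = go em
      where
      go : ∀ d → ∃[ k ] patchRow x (λ _ _ _ → true) (suc i) d k m ≡ true
      go (yes p) = InX.covering q i p m
      go (no _)  = 0 , refl

    pad-coherent : ∀ {x} → InX x → Coherent (pad x)
    pad-coherent {x} q i k l₁ l₂ e = go em
      where
      go : ∀ d → patchRow x (λ _ _ _ → true) (suc i) d k l₁ ≡ patchRow x (λ _ _ _ → true) (suc i) d k l₂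
      go (yes p) = InX.coherent q i p k l₁ l₂ λ m →
        trans (patch-represents x _ i (≺-pred p) l₁ m) (trans (e m) (sym (patch-represents x _ i (≺-pred p) l₂ m)))
      go (no _)  = refl

    SameSets-beyond : ∀ {x x′ j} → ¬ (suc j ≺ n) → SameSets (pad x) (pad x′) j → SameSets (pad x) (pad x′) (suc j)
    SameSets-beyond {x} {x′} {j} ¬p (f , g) =
      (λ l → l , full l l) , (λ l → l , full l l)
      where
      full : ∀ l l′ → Sim (pad x) (pad x′) (suc j) l l′
      full l l′ = (λ k _ → let (k′ , s) = f k in k′ , pad-beyond x′ (suc j) l′ k′ ¬p , s) ,
                  (λ k′ _ → let (k , s) = g k′ in k , pad-beyond x (suc j) l k ¬p , s)

-- The dense requirements on the reduct

data Goal : Set where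
  inside    : ℕ → Goal
  covered   : ℕ → ℕ → Goal
  inhabited : ℕ → ℕ → Goal
  rows      : ℕ → ℕ → ℕ → Goal

abstract
  goals : Countable Goal
  goals = countable-image f onto
    (countable-× countable-ℕ (countable-× countable-ℕ (countable-× countable-ℕ countable-ℕ)))
    where
    f : ℕ × ℕ × ℕ × ℕ → Goal
    f (0 , k , _ , _)  = inside k
    f (1 , i , m , _)  = covered i m
    f (2 , i , k , _)  = inhabited i k
    f (_ , i , l , l′) = rows i l l′
    onto : ∀ g → ∃[ q ] f q ≡ g
    onto (inside k)      = (0 , k , 0 , 0) , refl
    onto (covered i m)   = (1 , i , m , 0) , refl
    onto (inhabited i k) = (2 , i , k , 0) , refl
    onto (rows i l l′)   = (3 , i , l , l′) , refl

-- Beyond N, the diagonal bits N + k make the rows distinct and nonempty.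

module Completion (g : ℕ → Bool) (N : ℕ) where

  -- The block of ones on places below `N` lets row `N`, whose codes all lie beyond the prescribed
  -- part, cover these places.
  filler : ℕ → ℕ → Bool
  filler k m = if does (m <? N) then true else does (m ≟ N + k)

  completion : W
  completion i k m = if does (code i k m <? N) then g (code i k m) else filler k m

  completion-near : ∀ c → c < N → flat completion c ≡ g c
  completion-near c c< rewrite code-uncode c | dec-true (c <? N) c< = refl

  completion-far : ∀ i k m → N ≤ code i k m → completion i k m ≡ filler k m
  completion-far i k m N≤ rewrite dec-false (code i k m <? N) (≤⇒≯ N≤) = refl

  filler-far : ∀ k m → N ≤ m → filler k m ≡ does (m ≟ N + k)
  filler-far k m N≤ rewrite dec-false (m <? N) (≤⇒≯ N≤) = refl

  filler-near : ∀ k m → m < N → filler k m ≡ true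
  filler-near k m m< rewrite dec-true (m <? N) m< = refl

  completion-diagonal : ∀ i k → completion i k (N + k) ≡ true
  completion-diagonal i k = trans
    (completion-far i k (N + k) (≤-trans (m≤m+n N k) (place≤code i k (N + k))))
    (trans (filler-far k (N + k) (m≤m+n N k)) (dec-true (N + k ≟ N + k) refl))

  completion-covering : Covering completion
  completion-covering i m = go (m <? N)
    where
    go : Dec (m < N) → ∃[ k ] completion (suc i) k m ≡ true
    go (yes m<) = N , trans
      (completion-far (suc i) N m (≤-trans (snd≤pair (suc i) N) (slot≤code (suc i) N m))) (filler-near N m m<)
    go (no m≮)  = m ∸ N , subst (λ m′ → completion (suc i) (m ∸ N) m′ ≡ true) (m+[n∸m]≡n (≮⇒≥ m≮))
                                (completion-diagonal (suc i) (m ∸ N))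

  completion-rows : ∀ i l l′ → l ≢ l′ → completion i l (N + l) ≢ completion i l′ (N + l)
  completion-rows i l l′ l≢l′ e = l≢l′ (+-cancelˡ-≡ N l l′ (≡ᵇ⇒≡ (N + l) (N + l′) (subst T (sym filled) _)))
    where
    filled : does (N + l ≟ N + l′) ≡ true
    filled = trans (sym (trans
      (completion-far i l′ (N + l) (≤-trans (m≤m+n N l) (place≤code i l′ (N + l))))
      (filler-far l′ (N + l) (m≤m+n N l)))) (trans (sym e) (completion-diagonal i l))

  completion-coherent : Coherent completion
  completion-coherent i k l₁ l₂ e = go (l₁ ≟ l₂)
    where
    go : Dec (l₁ ≡ l₂) → completion (suc i) k l₁ ≡ completion (suc i) k l₂
    go (yes refl) = refl
    go (no ≢)     = contradiction (e (N + l₁)) (completion-rows i l₁ l₂ ≢)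

-- The reduction into a comeager set

module Theorem (em : ExcludedMiddle 0ℓ) (n : ℕ ⁺) (1≤n : [ 1 ] ≤⁺ n)
               (G : ℕ → Pred (Carrier (X n)) 0ℓ)
               (G-open : ∀ k → Open (X n) (G k)) (G-dense : ∀ k → Dense (X n) (G k)) where
  open Classical em
  open Padding {n} em

  Holds : Goal → W → Set
  -- Conditional on membership in X_n, so that it makes sense for every `w`; that the reduct is in
  -- X_n comes from the other goals.
  Holds (inside k)      w = (q : InX (restrict w)) → G k (restrict w , q)
  Holds (covered i m)   w = ∃[ k ] w (suc i) k m ≡ true
  Holds (inhabited i k) w = ∃[ m ] w (suc i) k m ≡ true
  Holds (rows i l l′)   w = l ≢ l′ → ∃[ m ] w i l m ≢ w i l′ m

  U : ℕ → W → Set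
  U t = Holds (proj₁ goals t)

  reach : ∀ goal → ∃[ t ] (∀ w → U t w → Holds goal w)
  reach goal = let (t , e) = proj₂ goals goal in t , λ w → subst (λ goal → Holds goal w) e

  Near : ℕ → W → W → Set
  Near M w v = ∀ i k m → code i k m < M → v i k m ≡ w i k m

  prefixOf : ∀ goal (g : ℕ → Bool) N w → (∀ c → c < N → flat w c ≡ g c) →
    ∃[ M ] (∀ v → Near M w v → Holds goal v) →
    ∃[ σ ] N ≤ length σ × (∀ c → c < N → at σ c ≡ g c) × (∀ v → Meets v σ → Holds goal v)
  prefixOf goal g N w near (M , holds) =
    σ , subst (N ≤_) (sym len) (m≤m⊔n N M) ,
    (λ c c< → trans (nth-applyUpTo (flat w) (<-≤-trans c< (m≤m⊔n N M))) (near c c<)) ,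
    λ v meets → holds v λ i k m c< →
      let c<′ = <-≤-trans c< (m≤n⊔m N M) in
      trans (meets i k m (subst (code i k m <_) (sym len) c<′))
            (trans (nth-applyUpTo (flat w) c<′) (flat-code w i k m))
    where
    σ : String
    σ = applyUpTo (flat w) (N ⊔ M)
    len : length σ ≡ N ⊔ M
    len = length-applyUpTo (flat w) (N ⊔ M)

  AgreesAt : W → Seqs n → ℕ × ℕ × ℕ → Set
  AgreesAt w x (i , k , m) = (p : i ≺ n) → x i p k m ≡ w i k m

  Cylinder : W → ℕ → Pred (Carrier (X n)) 0ℓ
  Cylinder w N (x , _) = ∀ c → c < N → AgreesAt w x (uncode c)

  private
    constraint : W → ∀ c → Dec (proj₁ (uncode c) ≺ n) → List (Coordinate n × Bool)
    constraint w c (yes p) = let (i , k , m) = uncode c in (coord i p k m , w i k m) ∷ []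
    constraint w c (no _)  = []

    constraints : W → ℕ → List (Coordinate n × Bool)
    constraints w zero    = []
    constraints w (suc N) = constraint w N em ++ constraints w N

    Satisfies : Seqs n → List (Coordinate n × Bool) → Set
    Satisfies x b = All (λ (c , v) → bit x c ≡ v) b

    satisfies : ∀ {x w} N → (∀ c → c < N → AgreesAt w x (uncode c)) → Satisfies x (constraints w N)
    satisfies zero    _ = []
    satisfies {x} {w} (suc N) f = All-++⁺ (go em) (satisfies N (λ c c< → f c (m<n⇒m<1+n c<)))
      where
      go : ∀ d → Satisfies x (constraint w N d)
      go (yes p) = f N (n<1+n N) p ∷ []
      go (no _)  = []

    satisfies⁻ : ∀ {x w} N → Satisfies x (constraints w N) → ∀ c → c < N → AgreesAt w x (uncode c)
    satisfies⁻ {x} {w} (suc N) s c c< p = case (m≤n⇒m<n∨m≡n (s≤s⁻¹ c<))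
      where
      go : ∀ d → Satisfies x (constraint w N d) → AgreesAt w x (uncode N)
      go (yes _) (e ∷ []) _ = e
      go (no ¬p) _        p = contradiction p ¬p
      case : c < N ⊎ c ≡ N → _
      case (inj₁ c<)   = satisfies⁻ N (All-++⁻ʳ (constraint w N em) s) c c< p
      case (inj₂ refl) = go em (All-++⁻ˡ (constraint w N em) s) p

  Cylinder-open : ∀ w N → Open (X n) (Cylinder w N)
  Cylinder-open w N (x , _) x∈ = constraints w N , satisfies N x∈ , satisfies⁻ N

  private
    extent : (b : List (Coordinate n × Bool)) →
      ∃[ M ] All (λ (c , _) → code (Coordinate.row c) (Coordinate.column c) (Coordinate.place c) < M) b
    extent []            = 0 , []
    extent ((coord i _ k m , _) ∷ b) = let (M , p) = extent b in
      suc (code i k m) ⊔ M , m≤m⊔n _ M ∷ All.map (λ c< → <-≤-trans c< (m≤n⊔m (suc (code i k m)) M)) p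

  -- Complete `g` to a point of X_n and move it into `G k` inside its cylinder by density. Openness
  -- then rests on finitely many bits, and rows beyond `n` keep the values of the completion.
  inside-dense : ∀ k (g : ℕ → Bool) N → ∃[ σ ] N ≤ length σ × (∀ c → c < N → at σ c ≡ g c) ×
                 (∀ v → Meets v σ → Holds (inside k) v)
  inside-dense k g N =
    let ((y , q) , y∈ , y∈G) = G-dense k (Cylinder completion N) (Cylinder-open completion N)
          ((restrict completion , restrict-InX completion-coherent completion-covering
             (λ i k → N + k , completion-diagonal (suc i) k)) , λ _ _ _ → refl)
        (b , y∈b , b⊆G) = G-open k (y , q) y∈G
        (M , b<M) = extent b
    in prefixOf (inside k) g N (patch y completion)
         (λ c c< → trans (patched y c (y∈ c c<)) (completion-near c c<))
         (M , λ v near q → b⊆G {restrict v , q} (inBox y v near b b<M y∈b))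
    where
    open Completion g N
    patched : ∀ y c → AgreesAt completion y (uncode c) → flat (patch y completion) c ≡ flat completion c
    patched y c agree = go em
      where
      go : ∀ d → patchRow y completion (proj₁ (uncode c)) d (proj₁ (proj₂ (uncode c))) (proj₂ (proj₂ (uncode c)))
                 ≡ flat completion c
      go (yes p) = agree p
      go (no _)  = refl
    inBox : ∀ y v {M} → Near M (patch y completion) v → ∀ b →
      All (λ (c , _) → code (Coordinate.row c) (Coordinate.column c) (Coordinate.place c) < M) b →
      Satisfies y b → Satisfies (restrict v) b
    inBox y v near []                       _         _        = []
    inBox y v near ((coord i p k m , _) ∷ b) (c< ∷ cs) (e ∷ es) =
      trans (trans (near i k m c<) (sym (patch-represents y completion i (recompute em p) k m))) e ∷
      inBox y v near b cs es

  goal-dense : ∀ goal (g : ℕ → Bool) N → ∃[ σ ] N ≤ length σ × (∀ c → c < N → at σ c ≡ g c) ×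
               (∀ v → Meets v σ → Holds goal v)
  goal-dense (inside k) g N = inside-dense k g N
  goal-dense (covered i m) g N =
    let (k , e) = completion-covering i m in
    prefixOf (covered i m) g N completion completion-near
      (suc (code (suc i) k m) , λ v near → k , trans (near (suc i) k m (n<1+n _)) e)
    where open Completion g N
  goal-dense (inhabited i k) g N =
    prefixOf (inhabited i k) g N completion completion-near
      (suc (code (suc i) k (N + k)) , λ v near →
        N + k , trans (near (suc i) k (N + k) (n<1+n _)) (completion-diagonal (suc i) k))
    where open Completion g N
  goal-dense (rows i l l′) g N =
    prefixOf (rows i l l′) g N completion completion-near
      (suc (code i l (N + l)) ⊔ suc (code i l′ (N + l)) , λ v near l≢l′ →
        N + l , λ e → completion-rows i l l′ l≢l′
          (trans (sym (near i l (N + l) (m≤m⊔n (suc (code i l (N + l))) (suc (code i l′ (N + l)))))) (trans e (near i l′ (N + l) (m≤n⊔m (suc (code i l (N + l))) (suc (code i l′ (N + l))))))))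
    where open Completion g N

  dense : DenseFamily (Forces U)
  dense t = goal-dense (proj₁ goals t)

  open Construction em (Forces U) dense using (reduct)
  open Reduction em U dense (λ i l l′ → reach (rows i l l′)) (λ i m → reach (covered i m))

  reduced : Carrier (X n) → W
  reduced (x , _) = reduct (pad x)

  reduced-InX : ∀ x → InX {n} (restrict (reduced x))
  reduced-InX (x , _) = restrict-InX (reduct-coherent (pad x)) (reduct-covering (pad x))
    (λ i k → let (t , holds) = reach (inhabited i k) in holds _ (reduct-meets (pad x) t))

  f : Carrier (X n) → Carrier (X n)
  f x = restrict (reduced x) , reduced-InX x

  f∈G : ∀ x k → G k (f x)
  f∈G x@(x₀ , _) k = let (t , holds) = reach (inside k) in holds _ (reduct-meets (pad x₀) t) (reduced-InX x)

  before : ∀ (x y : Carrier (X n)) j (p : j ≺ n) →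
    A (proj₁ x) j p ≈ A (proj₁ y) j p ⇔ SameSets (pad (proj₁ x)) (pad (proj₁ y)) j
  before (x , _) (y , _) = A≈⇔SameSets (patch-represents x _) (patch-represents y _)

  after : ∀ (x y : Carrier (X n)) j (p : j ≺ n) →
    A (proj₁ (f x)) j p ≈ A (proj₁ (f y)) j p ⇔ SameSets (reduced x) (reduced y) j
  after x y = A≈⇔SameSets (λ _ _ _ _ → refl) (λ _ _ _ _ → refl)

  f-preserves : ∀ x y → (∀ i → SameSets (pad (proj₁ x)) (pad (proj₁ y)) i) →
    ∀ j (p : j ≺ n) → A (proj₁ (f x)) j p ≈ A (proj₁ (f y)) j p
  f-preserves x@(_ , q) y@(_ , q′) same j p =
    Equivalence.from (after x y j p) (reduct-preserves (pad-coherent q) (pad-coherent q′) same j)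

  f-reflects : ∀ x y j (p : j ≺ n) →
    A (proj₁ (f x)) j p ≈ A (proj₁ (f y)) j p → A (proj₁ x) j p ≈ A (proj₁ y) j p
  f-reflects x@(_ , q) y@(_ , q′) j p e = Equivalence.from (before x y j p)
    (reduct-reflects (pad-coherent q) (pad-coherent q′) j (Equivalence.to (after x y j p) e))

  coordinates : Countable (Coordinate n)
  coordinates = (λ c → select (uncode c) em) , λ (coord i p k m) →
    code i k m , subst (λ q → ∀ d → select q d ≡ coord i p k m) (sym (uncode-code i k m)) (onto i (recompute em p) k m) em
    where
    select : ∀ (q : ℕ × ℕ × ℕ) → Dec (proj₁ q ≺ n) → Coordinate n
    select (i , k , m) (yes p) = coord i p k m
    -- A dummy value for codes of rows beyond `n`.
    select _           (no _)  = coord 0 1≤n 0 0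
    onto : ∀ i (p : i ≺ n) k m d → select (i , k , m) d ≡ coord i p k m
    onto i p k m (yes _) = refl
    onto i p k m (no ¬p) = contradiction p ¬p

  open BorelSets em (X n)
  open BorelReduct em (Forces U) dense (X n) (λ x → pad (proj₁ x))

  measurable-pad : ∀ i k m → Measurable (λ (x : Carrier (X n)) → pad (proj₁ x) i k m)
  measurable-pad i k m v = go em
    where
    go : ∀ d → Borel (X n) (λ (x , _) → patchRow x (λ _ _ _ → true) i d k m ≡ v)
    go (yes p) = open-set λ _ e → (coord i p k m , v) ∷ [] , e ∷ [] , λ { (e ∷ []) → e }
    go (no _)  = borel-const (true ≡ v)

  borel-preimage : ∀ (b : List (Coordinate n × Bool)) → Borel (X n) (λ x → All (λ (c , v) → bit (proj₁ (f x)) c ≡ v) b)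
  borel-preimage []      = resp-≐ ((λ _ → []) , (λ _ → refl)) (borel-const (0 ≡ 0))
  borel-preimage ((coord i _ k m , v) ∷ b) = resp-≐ ((λ (e , es) → e ∷ es) , (λ { (e ∷ es) → e , es }))
    (borel-× (measurable-reduct measurable-pad i k m v) (borel-preimage b))

  module _ (C : Pred (Carrier (X n)) 0ℓ) (G⊆C : ∀ {x} → (∀ k → G k x) → C x) where

    reduction : Carrier (X n) → Σ (Carrier (X n)) C
    reduction x = f x , G⊆C (f∈G x)

    -- The base is countable, so the preimage of `V` is a countable union of preimages of the basic
    -- sets contained in `V`.
    reduction-borel : BorelMap (X n) (Subspace (X n) C) reduction
    reduction-borel V V-open = resp-≐
      ((λ (b , b⊆V , e) → b⊆V _ e) ,
       λ {x} x∈V → let (b , e , b⊆V) = V-open (reduction x) x∈V in b , (λ _ → b⊆V) , e)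
      (borel-∃ (countable-List (countable-× coordinates countable-Bool)) λ b →
        borel-× (borel-const (∀ z → All (λ (c , v) → bit (proj₁ (proj₁ z)) c ≡ v) b → V z)) (borel-preimage b))

theorem5p1 :
    -- the ambient classical logic
    (∀ {ℓ} → ExcludedMiddle ℓ) →
    (n : ℕ ⁺) (1≤n : [ 1 ] ≤⁺ n) →
    (C : Pred (Carrier (X n)) 0ℓ) → Comeager (X n) C →
    BorelReducible (X n) (Subspace (X n) C) (F n 1≤n) (F n 1≤n ↾ C)
theorem5p1 em [ zero ] [ () ]≤
theorem5p1 em n@([ suc j ]) 1≤n C (G , G-open , G-dense , G⊆C) =
  reduction C G⊆C , reduction-borel C G⊆C ,
  λ x y → mk⇔ (λ e → f-preserves x y (all x y (Equivalence.to (before x y j top≺) e)) j top≺)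
              (f-reflects x y j top≺)
  where
  open Theorem em n 1≤n G G-open G-dense
  open Padding {n} em
  top≺ : j ≺ n
  top≺ = [ ≤-refl ]≤
  -- For finite `n` the relation compares level `j` only, while objects use places of all levels:
  -- lower ones agree by covering, higher ones by the constant padding.
  all : ∀ (x y : Carrier (X n)) → SameSets (pad (proj₁ x)) (pad (proj₁ y)) j →
        ∀ i → SameSets (pad (proj₁ x)) (pad (proj₁ y)) i
  all (x , q) (y , q′) same i = go (≤-total i j)
    where
    above : ∀ {i} → j ≤′ i → SameSets (pad x) (pad y) i
    above ≤′-refl         = same
    above (≤′-step j≤i) = SameSets-beyond (λ { [ i≤j ]≤ → <⇒≱ (s≤s⁻¹ i≤j) (≤′⇒≤ j≤i) }) (above j≤i)
    go : i ≤ j ⊎ j ≤ i → SameSets (pad x) (pad y) i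
    go (inj₁ i≤j) = SameSets-≤ (pad-covering q) (pad-covering q′) i≤j same
    go (inj₂ j≤i) = above (≤⇒≤′ j≤i)
theorem5p1 em ⊤⁺ 1≤n C (G , G-open , G-dense , G⊆C) =
  reduction C G⊆C , reduction-borel C G⊆C ,
  λ x y → mk⇔ (λ e → λ j → f-preserves x y (λ i → Equivalence.to (before x y i (_ ≤⊤⁺)) (e i)) j (_ ≤⊤⁺))
              (λ e j → f-reflects x y j (_ ≤⊤⁺) (e j))
  where open Theorem em ⊤⁺ 1≤n G G-open G-dense
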